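{- Let $p_n$ be the proportion of permutations $\gamma\in\mathcal S_n$ for which there exist $\alpha,\beta\in\mathcal S_n$ with $(\alpha,\beta,\gamma;(12))\in\mathrm{Par}(n)$. Then $p_n\to0$ as $n\to\infty$.
   Context: A Latin square of order $n$ is an $n\times n$ array with rows, columns and symbols indexed by $[n]$, each symbol occurring once in each row and each column, with triple set $O(L)$. Permutations act on the right. A paratopism $(\alpha,\beta,\gamma;(12))$ with $\alpha,\beta,\gamma\in\mathcal S_n$ maps $L$ to $L^\sigma$ with triple set $\{(y\beta,x\alpha,z\gamma):(x,y,z)\in O(L)\}$; it is an autoparatopism of $L$ if $L^\sigma=L$. $\mathrm{Par}(n)$ is the set of paratopisms that are autoparatopisms of at least one Latin square of order $n$. -}

module Defs where

open import Data.Fin.Base using (Fin; zero; suc; punchIn)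
open import Data.Fin.Permutation using (Permutation′; _⟨$⟩ʳ_; _≈_; id; insert; remove; insert-remove)
open import Data.Fin.Properties using (_≟_; all?; any?; punchIn-injective)
open import Data.Integer.Base using (+_)
open import Data.List.Base using (List; []; _∷_; [_]; length; map; filter; allFin; cartesianProductWith)
open import Data.List.Membership.Propositional.Properties using (∈-allFin)
open import Data.List.Properties using (length-++; length-map; length-tabulate)
open import Data.List.Relation.Unary.All using ([])
open import Data.List.Relation.Unary.AllPairs using ([]; _∷_)
open import Data.List.Relation.Unary.Any as Any using (Any; here)
import Data.List.Relation.Unary.Any.Properties as Anyₚ
import Data.List.Relation.Unary.Unique.Propositional.Properties as Uniqueₚ
import Data.List.Relation.Unary.Unique.Setoid as Unique
import Data.List.Relation.Unary.Unique.Setoid.Properties as Uniqueₛ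
open import Data.Nat.Base using (ℕ; zero; suc; _+_; _*_; _≥_; _!)
open import Data.Nat.Properties using (_!≢0)
open import Data.Product.Base using (∃; ∃-syntax; _×_; _,_; proj₁)
open import Data.Product using (∃!)
open import Data.Rational.Base using (ℚ; _/_; _-_; ∣_∣; _<_; 0ℚ)
open import Data.Vec.Base using (Vec; []; _∷_; lookup)
open import Function.Base using (_∘_)
open import Level using (0ℓ)
open import Relation.Binary.Bundles using (Setoid)
open import Relation.Binary.PropositionalEquality using (_≡_; refl; sym; trans; cong; cong₂; setoid)
open import Relation.Nullary using (Dec; yes; no; map′; _×-dec_; _→-dec_)
open import Relation.Unary using (Pred; Decidable; _≐_)

private
  variable
    n : ℕ

Array : ℕ → Set
Array n = Vec (Vec (Fin n) n) n

entry : Array n → Fin n → Fin n → Fin n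
entry A x y = lookup (lookup A x) y

record IsLatin (A : Array n) : Set where
  constructor isLatin
  field
    row    : ∀ x z → ∃! _≡_ λ y → entry A x y ≡ z
    column : ∀ y z → ∃! _≡_ λ x → entry A x y ≡ z

record LatinSquare (n : ℕ) : Set where
  constructor latinSquare
  field
    array : Array n
    latin : IsLatin array

open LatinSquare public

Triple : ℕ → Set
Triple n = Fin n × Fin n × Fin n

O : LatinSquare n → Pred (Triple n) 0ℓ
O L (x , y , z) = entry (array L) x y ≡ z

-- The paratopism (α, β, γ; (12)).
record Paratopism₁₂ (n : ℕ) : Set where
  constructor paratopism₁₂
  field
    α β γ : Permutation′ n

-- The triple set of L^σ.  Permutations act on the right, so xα is
-- α ⟨$⟩ʳ x.
O^ : LatinSquare n → Paratopism₁₂ n → Pred (Triple n) 0ℓ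
O^ L (paratopism₁₂ α β γ) t =
  ∃[ x ] ∃[ y ] ∃[ z ] O L (x , y , z) × t ≡ (β ⟨$⟩ʳ y , α ⟨$⟩ʳ x , γ ⟨$⟩ʳ z)

IsAutoparatopism : LatinSquare n → Paratopism₁₂ n → Set
IsAutoparatopism L σ = O^ L σ ≐ O L

-- The members of Par(n) of the form (α, β, γ; (12)).
Par : (n : ℕ) → Pred (Paratopism₁₂ n) 0ℓ
Par n σ = ∃[ L ] IsAutoparatopism {n} L σ

IsThirdComponent : (n : ℕ) → Pred (Permutation′ n) 0ℓ
IsThirdComponent n γ = ∃[ α ] ∃[ β ] Par n (paratopism₁₂ α β γ)

permutations : (n : ℕ) → List (Permutation′ n)
permutations zero    = [ id ]
permutations (suc n) = cartesianProductWith (insert zero) (allFin (suc n)) (permutations n)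

permutationSetoid : ℕ → Setoid 0ℓ 0ℓ
permutationSetoid n = record
  { Carrier       = Permutation′ n
  ; _≈_           = _≈_
  ; isEquivalence = record
    { refl  = λ _ → refl
    ; sym   = λ p i → sym (p i)
    ; trans = λ p q i → trans (p i) (q i)
    }
  }

permutations-complete : (π : Permutation′ n) → Any (π ≈_) (permutations n)
permutations-complete {zero}  π = here λ ()
permutations-complete {suc n} π =
  Anyₚ.cartesianProductWith⁺ (insert zero) step
    (∈-allFin (π ⟨$⟩ʳ zero)) (permutations-complete (remove zero π))
  where
  step : ∀ {j ρ} → π ⟨$⟩ʳ zero ≡ j → remove zero π ≈ ρ → π ≈ insert zero j ρ
  step refl r zero    = refl
  step refl r (suc i) = trans (sym (insert-remove zero π (suc i))) (cong (punchIn (π ⟨$⟩ʳ zero)) (r i))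

permutations-unique : (n : ℕ) → Unique.Unique (permutationSetoid n) (permutations n)
permutations-unique zero    = [] ∷ []
permutations-unique (suc n) =
  Uniqueₛ.cartesianProductWith⁺ (setoid (Fin (suc n))) (permutationSetoid n) (permutationSetoid (suc n))
    (insert zero) (λ {i} {j} {π} {ρ} → inj {i} {j} {π} {ρ}) (Uniqueₚ.allFin⁺ (suc n)) (permutations-unique n)
  where
  inj : ∀ {i j} {π ρ : Permutation′ n} → insert zero i π ≈ insert zero j ρ → i ≡ j × π ≈ ρ
  inj {i} {j} {π} {ρ} p with refl ← p zero = refl , λ k → punchIn-injective i (π ⟨$⟩ʳ k) (ρ ⟨$⟩ʳ k) (p (suc k))

private
  length-cartesianProductWith : {A B C : Set} (f : A → B → C) (xs : List A) (ys : List B) →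
    length (cartesianProductWith f xs ys) ≡ length xs * length ys
  length-cartesianProductWith f []       ys = refl
  length-cartesianProductWith f (x ∷ xs) ys =
    trans (length-++ (map (f x) ys))
          (cong₂ _+_ (length-map (f x) ys) (length-cartesianProductWith f xs ys))

length-permutations : (n : ℕ) → length (permutations n) ≡ n !
length-permutations zero    = refl
length-permutations (suc n) =
  trans (length-cartesianProductWith (insert zero) (allFin (suc n)) (permutations n))
        (cong₂ _*_ (length-tabulate {n = suc n} (λ i → i)) (length-permutations n))

private
  anyVec? : {A : Set} → (∀ {P : Pred A 0ℓ} → Decidable P → Dec (∃ P)) →
            ∀ {m} {P : Pred (Vec A m) 0ℓ} → Decidable P → Dec (∃ P)
  anyVec? any {zero}  P? = map′ (λ p → [] , p) (λ { ([] , p) → p }) (P? [])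
  anyVec? any {suc m} P? =
    map′ (λ { (a , v , p) → a ∷ v , p }) (λ { (a ∷ v , p) → a , v , p })
      (any λ a → anyVec? any λ v → P? (a ∷ v))

  anyArray? : ∀ {P : Pred (Array n) 0ℓ} → Decidable P → Dec (∃ P)
  anyArray? = anyVec? (anyVec? any?)

  ∃!? : {P : Pred (Fin n) 0ℓ} → Decidable P → Dec (∃! _≡_ P)
  ∃!? P? =
    map′ (λ { (x , p , u) → x , p , λ {y} → u y }) (λ { (x , p , u) → x , p , λ y → u {y} })
      (any? λ x → P? x ×-dec all? λ y → P? y →-dec x ≟ y)

  isLatin? : Decidable (IsLatin {n})
  isLatin? A = map′ (λ { (r , c) → isLatin r c }) (λ { (isLatin r c) → r , c })
    (all? (λ x → all? λ z → ∃!? λ y → entry A x y ≟ z) ×-dec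
     all? (λ y → all? λ z → ∃!? λ x → entry A x y ≟ z))

  _≟ₜ_ : (s t : Triple n) → Dec (s ≡ t)
  (a , b , c) ≟ₜ (x , y , z) =
    map′ (λ { (refl , refl , refl) → refl }) (λ { refl → refl , refl , refl })
      (a ≟ x ×-dec b ≟ y ×-dec c ≟ z)

  allTriple? : {P : Pred (Triple n) 0ℓ} → Decidable P → Dec (∀ {t} → P t)
  allTriple? P? = map′ (λ { f {x , y , z} → f x y z }) (λ f x y z → f)
    (all? λ x → all? λ y → all? λ z → P? (x , y , z))

  O? : (L : LatinSquare n) → Decidable (O L)
  O? L (x , y , z) = entry (array L) x y ≟ z

  O^? : (L : LatinSquare n) (σ : Paratopism₁₂ n) → Decidable (O^ L σ)
  O^? L σ t = any? λ x → any? λ y → any? λ z → O? L (x , y , z) ×-dec (t ≟ₜ _)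

  isAutoparatopism? : (L : LatinSquare n) → Decidable (IsAutoparatopism L)
  isAutoparatopism? L σ =
    allTriple? (λ t → O^? L σ t →-dec O? L t) ×-dec allTriple? (λ t → O? L t →-dec O^? L σ t)

  Par? : Decidable (Par n)
  Par? σ =
    map′ (λ { (A , l , a) → latinSquare A l , a }) (λ { (latinSquare A l , a) → A , l , a })
      (anyArray? λ A → ∃-dec (isLatin? A) λ l → isAutoparatopism? (latinSquare A l) σ)
    where
    -- IsAutoparatopism L σ depends on L only through its array.
    ∃-dec : ∀ {A} → Dec (IsLatin A) → (∀ l → Dec (IsAutoparatopism (latinSquare A l) σ)) →
            Dec (∃[ l ] IsAutoparatopism (latinSquare A l) σ)
    ∃-dec (yes l) d = map′ (λ a → l , a) (λ { (_ , f , g) → f , g }) (d l)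
    ∃-dec (no ¬l) d = no (¬l ∘ proj₁)

  Par-resp : ∀ {α α′ β β′ γ : Permutation′ n} → α ≈ α′ → β ≈ β′ →
             Par n (paratopism₁₂ α β γ) → Par n (paratopism₁₂ α′ β′ γ)
  Par-resp a b (L , f , g) = L ,
    (λ { (x , y , z , o , refl) → f (x , y , z , o , cong₂ (λ u v → u , v , _) (sym (b y)) (sym (a x))) }) ,
    (λ o′ → let (x , y , z , o , e) = g o′ in
      x , y , z , o , trans e (cong₂ (λ u v → u , v , _) (b y) (a x)))

  anyPermutation? : {P : Pred (Permutation′ n) 0ℓ} → (∀ {π ρ} → π ≈ ρ → P π → P ρ) →
                    Decidable P → Dec (∃ P)
  anyPermutation? resp P? = map′ Any.satisfied
    (λ { (π , p) → Any.map (λ {ρ} e → resp {π} {ρ} e p) (permutations-complete π) })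
    (Any.any? P? (permutations _))

isThirdComponent? : (n : ℕ) → Decidable (IsThirdComponent n)
isThirdComponent? n γ =
  anyPermutation?
    (λ {α} {α′} e → λ { (β , p) → β , Par-resp {α = α} {α′} {β} {β} {γ} e (λ _ → refl) p })
    λ α → anyPermutation?
      (λ {β} {β′} e → Par-resp {α = α} {α} {β} {β′} {γ} (λ _ → refl) e)
      λ β → Par? (paratopism₁₂ α β γ)

p : ℕ → ℚ
p n = _/_ (+ length (filter (isThirdComponent? n) (permutations n))) (n !) {{n !≢0}}

infix 4 _⟶_

_⟶_ : (ℕ → ℚ) → ℚ → Set
u ⟶ l = ∀ (ε : ℚ) → 0ℚ < ε → ∃[ N ] (∀ n → n ≥ N → ∣ u n - l ∣ < ε)

{-# OPTIONS --safe #-}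

-- Let σ = (α, β, γ; (12)) be an autoparatopism of L.  Then σ² = (αβ, βα, γ²)
-- is an autotopism, and αβ, βα are conjugate.  For a prime power q dividing
-- the length of a cycle of γ², either q divides the length of every cycle of
-- αβ, so q ∣ n, or at least half of the symbols lie in cycles of γ² of length
-- divisible by q.  Expose the cycles of a random γ one after another.  After
-- J cycles, of lengths c₁, …, c_J, more than half of the points are used with
-- probability at least 1 − 2 / 2^J, and then every such q divides
-- n c₁ ⋯ c_J, so the length of the next cycle divides 2 n c₁ ⋯ c_J.  This
-- number is at most 2 n^(J+1) and hence has only n^o(1) divisors, whereas the
-- length of the next cycle is uniformly distributed on an interval which is
-- typically of length comparable to n.
module Submission where

open import Defs using (LatinSquare; IsLatin; array; latin; entry; paratopism₁₂; IsAutoparatopism; IsThirdComponent; isThirdComponent?; permutations; permutations-unique; permutationSetoid; p; _⟶_)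
open import Data.Fin.Base using (Fin; toℕ)
open import Data.Fin.Permutation using (Permutation′; _⟨$⟩ʳ_; _⟨$⟩ˡ_; inverseʳ)
open import Data.Fin.Properties using (_≟_; pigeonhole; ¬∀⟶∃¬; all?)
import Data.Integer.Base as ℤ
import Data.Integer.Properties as ℤ
open import Data.List.Base using (List; []; _∷_; [_]; _++_; length; map; filter; upTo; allFin; cartesianProductWith)
open import Data.List.Membership.Propositional using (_∈_)
open import Data.List.Membership.Propositional.Properties using (∈-allFin; ∈-cartesianProductWith⁺; ∈-map⁺; ∈-upTo⁺; ∈-++⁺ˡ; ∈-++⁺ʳ)
open import Data.List.Properties using (length-++; length-map; length-tabulate; length-upTo)
open import Data.List.Relation.Unary.All as All using (All; []; _∷_)
open import Data.List.Relation.Unary.All.Properties using (all-filter)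
open import Data.List.Relation.Unary.AllPairs using (AllPairs; []; _∷_)
open import Data.List.Relation.Unary.Any using (here; there)
open import Data.List.Relation.Unary.Unique.Propositional using (Unique)
open import Data.List.Relation.Unary.Unique.Propositional.Properties using (allFin⁺)
import Data.List.Relation.Unary.Unique.Setoid.Properties as Uniqueₛ
open import Data.Nat.Base hiding (_/_; _%_)
open import Data.Nat.Coprimality using (Coprime)
open import Data.Nat.Divisibility
open import Data.Nat.DivMod using (_/_; _%_; m≡m%n+[m/n]*n; m%n<n; m/n*n≤m; m≥n⇒m/n>0; /-monoˡ-≤; m*n/n≡m)
open import Data.Nat.GeneralisedArithmetic using (fold; fold-+)
open import Data.Nat.Induction using (<-rec)
open import Data.Nat.LCM using (lcm; lcm-least; m∣lcm[m,n]; n∣lcm[m,n])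
open import Data.Nat.Primality using (Prime; prime?; euclidsLemma; prime⇒nonZero; prime⇒nonTrivial)
open import Data.Nat.Primality.Factorisation using (factorise)
open import Data.Nat.Properties hiding (_≟_)
open import Data.Nat.Tactic.RingSolver using (solve-∀)
open import Data.Product.Base using (∃₂; ∃-syntax; _×_; _,_; proj₁; proj₂)
open import Data.Rational.Base as ℚ using (0ℚ; mkℚ; *<*)
import Data.Rational.Properties as ℚ
import Data.Rational.Unnormalised.Base as ℚᵘ
import Data.Rational.Unnormalised.Properties as ℚᵘ
open import Data.Sum.Base as Sum using (_⊎_; inj₁; inj₂; [_,_]′)
open import Function.Bundles using (Injection)
open import Function.Definitions using (Injective)
open import Function.Properties.Inverse using (↔⇒↣)
open import Relation.Binary.PropositionalEquality hiding ([_]; J)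
open import Relation.Nullary using (Dec; ¬_; yes; no; contradiction; _×-dec_)

-- Prime powers and divisors

length-cartesianProductWith : {A B C : Set} (f : A → B → C) (xs : List A) (ys : List B) →
  length (cartesianProductWith f xs ys) ≡ length xs * length ys
length-cartesianProductWith f []       ys = refl
length-cartesianProductWith f (x ∷ xs) ys =
  trans (length-++ (map (f x) ys))
        (cong₂ _+_ (length-map (f x) ys) (length-cartesianProductWith f xs ys))

∤⇒nonZero : ∀ {p r} → p ∤ r → NonZero r
∤⇒nonZero {p} {zero}  p∤0 = contradiction (p ∣0) p∤0
∤⇒nonZero {p} {suc r} _   = _

primeDivisor : ∀ m .{{_ : NonTrivial m}} → ∃[ p ] Prime p × p ∣ m
primeDivisor m@(2+ _) with factorise m
... | record { factors = []    ; isFactorisation = () }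
... | record { factors = p ∷ ps ; isFactorisation = eq ; factorsPrime = pp ∷ _ } =
  p , pp , subst (p ∣_) (sym eq) (m∣m*n _)

record Split (p m : ℕ) : Set where
  constructor split
  field
    exponent cofactor : ℕ
    equality          : m ≡ p ^ exponent * cofactor
    indivisible       : p ∤ cofactor

splitPrime : ∀ {p} → Prime p → ∀ m .{{_ : NonZero m}} → Split p m
splitPrime {p} pp = <-rec _ go
  where
  instance _ = prime⇒nonTrivial pp
  go : ∀ m → (∀ {k} → k < m → .{{_ : NonZero k}} → Split p k) → .{{_ : NonZero m}} → Split p m
  go m rec with p ∣? m
  ... | no p∤m = split 0 m (sym (+-identityʳ m)) p∤m
  ... | yes p∣m@(divides k eq) with rec {k} (quotient-< p∣m) {{quotient≢0 p∣m}}
  ...   | split e r eq′ p∤r = split (suc e) r (trans eq (trans (cong (_* p) eq′) (rearrange p (p ^ e) r))) p∤r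
    where
    rearrange : ∀ p q r → q * r * p ≡ p * q * r
    rearrange = solve-∀

module _ {p : ℕ} (pp : Prime p) where

  private instance
    p≢0 : NonZero p
    p≢0 = prime⇒nonZero pp

  ^∣*⇒^∣ʳ : ∀ e {r t} → p ∤ r → p ^ e ∣ r * t → p ^ e ∣ t
  ^∣*⇒^∣ʳ zero    _   _ = 1∣ _
  ^∣*⇒^∣ʳ (suc e) {r} {t} p∤r h with ^∣*⇒^∣ʳ e p∤r (∣-trans (n∣m*n p) h)
  ... | divides k refl
    with euclidsLemma r k pp (*-cancelˡ-∣ (p ^ e) {{m^n≢0 p e}} (subst₂ _∣_ (*-comm p (p ^ e)) (rearrange r k (p ^ e)) h))
    where
    rearrange : ∀ r k q → r * (k * q) ≡ q * (r * k)
    rearrange = solve-∀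
  ... | inj₁ p∣r = contradiction p∣r p∤r
  ... | inj₂ p∣k = *-monoˡ-∣ (p ^ e) p∣k

  ∣^*⇒∣ : ∀ e {d r} → p ∤ d → d ∣ p ^ e * r → d ∣ r
  ∣^*⇒∣ e {d} {r} p∤d (divides k eq) with ^∣*⇒^∣ʳ e p∤d (divides r (trans (*-comm d k) (trans (sym eq) (*-comm (p ^ e) r))))
  ... | divides j refl = divides j (*-cancelˡ-≡ r (j * d) (p ^ e) {{m^n≢0 p e}} (trans eq (rearrange j (p ^ e) d)))
    where
    rearrange : ∀ j q d → j * q * d ≡ q * (j * d)
    rearrange = solve-∀

  ^-monoʳ-∣ : ∀ {m n} → m ≤ n → p ^ m ∣ p ^ n
  ^-monoʳ-∣ {m} m≤n with k , refl ← m≤n⇒∃[o]m+o≡n m≤n =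
    subst (p ^ m ∣_) (sym (^-distribˡ-+-* p m k)) (m∣m*n _)

  ^∣^*⇒≤ : ∀ v e {r} → p ∤ r → p ^ v ∣ p ^ e * r → v ≤ e
  ^∣^*⇒≤ v e {r} p∤r h = ≮⇒≥ λ e<v → p∤r (*-cancelˡ-∣ (p ^ e) {{m^n≢0 p e}}
    (∣-trans (subst (_∣ p ^ v) (*-comm p (p ^ e)) (^-monoʳ-∣ e<v)) h))

  -- If `p` had exponent below `v` in both `a` and `b`, both would divide `p ^ pred v` times the
  -- product of their cofactors, hence so would the lcm, and `p ^ v` does not divide that number.
  primePower∣lcm : ∀ v a b .{{_ : NonZero a}} .{{_ : NonZero b}} →
                   p ^ v ∣ lcm a b → p ^ v ∣ a ⊎ p ^ v ∣ b
  primePower∣lcm v a b h with splitPrime pp a | splitPrime pp b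
  ... | split e a′ refl p∤a′ | split f b′ refl p∤b′ with v ≤? e | v ≤? f
  ... | yes v≤e | _       = inj₁ (∣m⇒∣m*n a′ (^-monoʳ-∣ v≤e))
  ... | no _    | yes v≤f = inj₂ (∣m⇒∣m*n b′ (^-monoʳ-∣ v≤f))
  ... | no v≰e  | no v≰f  = contradiction (^∣^*⇒≤ v (pred v) p∤a′b′ (∣-trans h (lcm-least a∣ b∣))) (<⇒≱ pred<v)
    where
    pred<v : pred v < v
    pred<v = ≤-reflexive (suc-pred v {{>-nonZero (≤-<-trans z≤n (≰⇒> v≰e))}})

    p∤a′b′ : p ∤ a′ * b′
    p∤a′b′ d = [ p∤a′ , p∤b′ ]′ (euclidsLemma a′ b′ pp d)

    a∣ : p ^ e * a′ ∣ p ^ pred v * (a′ * b′)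
    a∣ = *-pres-∣ (^-monoʳ-∣ (<⇒≤pred (≰⇒> v≰e))) (m∣m*n b′)

    b∣ : p ^ f * b′ ∣ p ^ pred v * (a′ * b′)
    b∣ = *-pres-∣ (^-monoʳ-∣ (<⇒≤pred (≰⇒> v≰f))) (n∣m*n a′)

splitPrime-< : ∀ {p m} .{{_ : NonZero m}} (pp : Prime p) → p ∣ m → (s : Split p m) → Split.cofactor s < m
splitPrime-< pp p∣m (split zero r refl p∤r) = contradiction (subst (_ ∣_) (+-identityʳ r) p∣m) p∤r
splitPrime-< {p} pp p∣m (split (suc e) r refl p∤r) = <-≤-trans
  (subst (r <_) (*-comm r p) (m<m*n r p (nonTrivial⇒n>1 p))) (*-monoˡ-≤ r (m≤m*n p (p ^ e)))
  where instance
    _ = prime⇒nonTrivial pp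
    _ = ∤⇒nonZero p∤r
    _ = prime⇒nonZero pp
    _ = m^n≢0 p e

-- Strong induction on `c = p ^ e * r` with `p ∤ r`: the hypothesis for `r` gives `M = t * r`, and
-- `p ^ e`, dividing `t * r`, divides `t`.
primePowers∣⇒∣ : ∀ {M} c .{{_ : NonZero c}} → (∀ {p} v → Prime p → p ^ v ∣ c → p ^ v ∣ M) → c ∣ M
primePowers∣⇒∣ {M} = <-rec _ go
  where
  go : ∀ c → (∀ {k} → k < c → .{{_ : NonZero k}} → (∀ {p} v → Prime p → p ^ v ∣ k → p ^ v ∣ M) → k ∣ M) →
       .{{_ : NonZero c}} → (∀ {p} v → Prime p → p ^ v ∣ c → p ^ v ∣ M) → c ∣ M
  go 1 _ _ = 1∣ M
  go c@(2+ _) rec h with primeDivisor c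
  ... | p , pp , p∣c with splitPrime pp c
  ... | s@(split e r c≡ p∤r)
    with rec (splitPrime-< pp p∣c s) {{∤⇒nonZero p∤r}}
             (λ v pp′ d → h v pp′ (∣-trans (∣n⇒∣m*n (p ^ e) d) (∣-reflexive (sym c≡))))
  ... | divides t refl = subst₂ _∣_ (sym c≡) refl
    (*-monoˡ-∣ r (^∣*⇒^∣ʳ pp e p∤r (subst (p ^ e ∣_) (*-comm t r) (h e pp (∣-trans (m∣m*n r) (∣-reflexive (sym c≡)))))))

-- Bounds for the number of divisors

DivisorCover : ℕ → List ℕ → Set
DivisorCover m ds = ∀ {c} → c ∣ m → c ∈ ds

divisorCover-split : ∀ {p} → Prime p → ∀ e {r ds} → p ∤ r → DivisorCover r ds →
  DivisorCover (p ^ e * r) (cartesianProductWith (λ i d → p ^ i * d) (upTo (suc e)) ds)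
divisorCover-split {p} pp e {r} p∤r cover {c} c∣ with splitPrime pp c {{c≢0}}
  where
  instance
    _ = prime⇒nonZero pp
    _ = m^n≢0 p e
    _ = ∤⇒nonZero p∤r
  c≢0 : NonZero c
  c≢0 = ≢-nonZero λ { refl → ≢-nonZero⁻¹ (p ^ e * r) {{m*n≢0 (p ^ e) r}} (0∣⇒≡0 c∣) }
... | split i d refl p∤d = ∈-cartesianProductWith⁺ _
  (∈-upTo⁺ (s≤s (^∣^*⇒≤ pp i e p∤r (∣-trans (m∣m*n d) c∣))))
  (cover (∣^*⇒∣ pp e p∤d (∣-trans (n∣m*n (p ^ i)) c∣)))

1+n≤2^n : ∀ n → suc n ≤ 2 ^ n
1+n≤2^n zero    = ≤-refl
1+n≤2^n (suc n) = ≤-trans (+-mono-≤ (m^n>0 2 n) (1+n≤2^n n)) (≤-reflexive (cong (2 ^ n +_) (sym (+-identityʳ _))))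

^-distribʳ-* : ∀ a b k → (a * b) ^ k ≡ a ^ k * b ^ k
^-distribʳ-* a b zero    = refl
^-distribʳ-* a b (suc k) = trans (cong (a * b *_) (^-distribʳ-* a b k)) (rearrange a b (a ^ k) (b ^ k))
  where
  rearrange : ∀ a b c d → a * b * (c * d) ≡ a * c * (b * d)
  rearrange = solve-∀

-- For `q = n / k` one has `n + 1 ≤ k (q + 1) ≤ k 2 ^ q`, and `q * k ≤ n` after raising to the power
-- `k`.
1+n^k≤k^k*2^n : ∀ n k .{{_ : NonZero k}} → suc n ^ k ≤ k ^ k * 2 ^ n
1+n^k≤k^k*2^n n k = begin
  suc n ^ k                  ≤⟨ ^-monoˡ-≤ k n<k[1+n/k] ⟩
  (k * 2 ^ (n / k)) ^ k      ≡⟨ ^-distribʳ-* k (2 ^ (n / k)) k ⟩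
  k ^ k * (2 ^ (n / k)) ^ k  ≡⟨ cong (k ^ k *_) (^-*-assoc 2 (n / k) k) ⟩
  k ^ k * 2 ^ (n / k * k)    ≤⟨ *-monoʳ-≤ (k ^ k) (^-monoʳ-≤ 2 (m/n*n≤m n k)) ⟩
  k ^ k * 2 ^ n              ∎
  where
  open ≤-Reasoning
  n<k[1+n/k] : suc n ≤ k * 2 ^ (n / k)
  n<k[1+n/k] = begin
    suc n                    ≡⟨ cong suc (m≡m%n+[m/n]*n n k) ⟩
    suc (n % k) + n / k * k  ≤⟨ +-monoˡ-≤ _ (m%n<n n k) ⟩
    suc (n / k) * k          ≤⟨ *-monoˡ-≤ k (1+n≤2^n (n / k)) ⟩
    2 ^ (n / k) * k          ≡⟨ *-comm _ k ⟩
    k * 2 ^ (n / k)          ∎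

-- Only the primes p < 2 ^ K contribute to the constant: for p ≥ 2 ^ K one has
-- (e + 1) ^ K ≤ 2 ^ (K e) ≤ p ^ e.
module DivisorBound (K : ℕ) (K≢0 : NonZero K) where

  private instance _ = K≢0

  -- The divisor bound d(m) = O(m ^ (1 / K)), raised to the power `K` to stay within the natural
  -- numbers.
  FewDivisors : ℕ → ℕ → Set
  FewDivisors C m = ∃[ ds ] DivisorCover m ds × length ds ^ K ≤ C * m

  RoughFrom : ℕ → ℕ → Set
  RoughFrom b m = ∀ {p} → Prime p → p ∣ m → b ≤ p

  -- The factor `p ^ e` multiplies the number of divisors by `e + 1`; the constant `B` is the price
  -- paid for `p`.
  fewDivisors-split : ∀ {p} → Prime p → ∀ e {r C} B → p ∤ r → suc e ^ K ≤ B * p ^ e →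
    FewDivisors C r → FewDivisors (B * C) (p ^ e * r)
  fewDivisors-split {p} pp e {r} {C} B p∤r bound (ds , cover , few) =
    _ , divisorCover-split pp e p∤r cover , (begin
      length (cartesianProductWith _ (upTo (suc e)) ds) ^ K  ≡⟨ cong (_^ K) (length-cartesianProductWith _ (upTo (suc e)) ds) ⟩
      (length (upTo (suc e)) * length ds) ^ K                ≡⟨ cong (λ l → (l * length ds) ^ K) (length-upTo (suc e)) ⟩
      (suc e * length ds) ^ K                                ≡⟨ ^-distribʳ-* (suc e) (length ds) K ⟩
      suc e ^ K * length ds ^ K                              ≤⟨ *-mono-≤ bound few ⟩
      B * p ^ e * (C * r)                                    ≡⟨ rearrange B (p ^ e) C r ⟩
      B * C * (p ^ e * r)                                    ∎)
    where
    open ≤-Reasoning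
    rearrange : ∀ a b c d → a * b * (c * d) ≡ a * c * (b * d)
    rearrange = solve-∀

  rough⇒fewDivisors : ∀ m .{{_ : NonZero m}} → RoughFrom (2 ^ K) m → FewDivisors 1 m
  rough⇒fewDivisors = <-rec _ go
    where
    go : ∀ m → (∀ {k} → k < m → .{{_ : NonZero k}} → RoughFrom (2 ^ K) k → FewDivisors 1 k) →
         .{{_ : NonZero m}} → RoughFrom (2 ^ K) m → FewDivisors 1 m
    go 1 _ _ = [ 1 ] , (λ c∣1 → here (∣1⇒≡1 c∣1)) , ≤-reflexive (^-zeroˡ K)
    go m@(2+ _) rec rough with primeDivisor m
    ... | p , pp , p∣m with splitPrime pp m
    ... | s@(split e r m≡ p∤r) = subst (FewDivisors 1) (sym m≡)
      (fewDivisors-split pp e {C = 1} 1 p∤r bound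
        (rec (splitPrime-< pp p∣m s) {{∤⇒nonZero p∤r}}
             (λ pp′ d → rough pp′ (∣-trans (∣n⇒∣m*n (p ^ e) d) (∣-reflexive (sym m≡))))))
      where
      open ≤-Reasoning
      bound : suc e ^ K ≤ 1 * p ^ e
      bound = begin
        suc e ^ K    ≤⟨ ^-monoˡ-≤ K (1+n≤2^n e) ⟩
        (2 ^ e) ^ K  ≡⟨ ^-*-assoc 2 e K ⟩
        2 ^ (e * K)  ≡⟨ cong (2 ^_) (*-comm e K) ⟩
        2 ^ (K * e)  ≡⟨ ^-*-assoc 2 K e ⟨
        (2 ^ K) ^ e  ≤⟨ ^-monoˡ-≤ e (rough pp p∣m) ⟩
        p ^ e        ≡⟨ +-identityʳ _ ⟨
        1 * p ^ e    ∎

  -- The candidates from `b` up to `2 ^ K` are removed from `m` one after another. There are `j` of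
  -- them left, and each is charged `K ^ K`, prime or not.
  fewDivisors-rough : ∀ j b → j + b ≡ 2 ^ K → ∀ m .{{_ : NonZero m}} → RoughFrom b m → FewDivisors ((K ^ K) ^ j) m
  fewDivisors-rough zero    b refl m rough = rough⇒fewDivisors m rough
  fewDivisors-rough (suc j) b j+b≡ m rough with prime? b
  ... | no ¬b = let (ds , cover , few) = rec in
    ds , cover , ≤-trans few (*-monoˡ-≤ m (m≤n*m _ (K ^ K) {{m^n≢0 K K}}))
    where
    rec = fewDivisors-rough j (suc b) (trans (+-suc j b) j+b≡) m
            (λ pp p∣m → ≤∧≢⇒< (rough pp p∣m) λ { refl → ¬b pp })
  ... | yes bp with splitPrime bp m
  ... | split e r refl b∤r = fewDivisors-split bp e (K ^ K) b∤r bound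
    (fewDivisors-rough j (suc b) (trans (+-suc j b) j+b≡) r {{∤⇒nonZero b∤r}}
      λ pp p∣r → ≤∧≢⇒< (rough pp (∣n⇒∣m*n (b ^ e) p∣r)) λ { refl → b∤r p∣r })
    where
    bound : suc e ^ K ≤ K ^ K * b ^ e
    bound = ≤-trans (1+n^k≤k^k*2^n e K) (*-monoʳ-≤ (K ^ K) (^-monoˡ-≤ e (nonTrivial⇒n>1 b {{prime⇒nonTrivial bp}})))

  constant : ℕ
  constant = (K ^ K) ^ (2 ^ K)

  fewDivisors : ∀ m .{{_ : NonZero m}} → FewDivisors constant m
  fewDivisors m = fewDivisors-rough (2 ^ K) 0 (+-identityʳ _) m (λ _ _ → z≤n)

-- Lists

data Pick {A : Set} : List A → ℕ → A → List A → Set where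
  here  : ∀ {x xs} → Pick (x ∷ xs) 0 x xs
  there : ∀ {x y xs ys i} → Pick xs i y ys → Pick (x ∷ xs) (suc i) y (x ∷ ys)

module _ {A : Set} where

  pick : ∀ {y : A} {xs} → y ∈ xs → ∃₂ λ i ys → Pick xs i y ys
  pick (here refl) = _ , _ , here
  pick (there y∈xs) = let (_ , _ , p) = pick y∈xs in _ , _ , there p

  pick-length : ∀ {y : A} {xs i ys} → Pick xs i y ys → length xs ≡ suc (length ys)
  pick-length here      = refl
  pick-length (there p) = cong suc (pick-length p)

  pick-< : ∀ {y : A} {xs i ys} → Pick xs i y ys → i < length xs
  pick-< here      = z<s
  pick-< (there p) = s<s (pick-< p)

  pick-deterministic : ∀ {y z : A} {xs i ys zs} → Pick xs i y ys → Pick xs i z zs → y ≡ z × ys ≡ zs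
  pick-deterministic here      here      = refl , refl
  pick-deterministic (there p) (there q) with refl , refl ← pick-deterministic p q = refl , refl

  pick-∈ : ∀ {y z : A} {xs i ys} → Pick xs i y ys → z ∈ xs → z ≡ y ⊎ z ∈ ys
  pick-∈ here      (here eq)  = inj₁ eq
  pick-∈ here      (there z∈) = inj₂ z∈
  pick-∈ (there p) (here eq)  = inj₂ (here eq)
  pick-∈ (there p) (there z∈) with pick-∈ p z∈
  ... | inj₁ eq  = inj₁ eq
  ... | inj₂ z∈′ = inj₂ (there z∈′)

  pick-All⁻ : ∀ {P : A → Set} {y xs i ys} → Pick xs i y ys → All P xs → P y × All P ys
  pick-All⁻ here      (py ∷ ps) = py , ps
  pick-All⁻ (there p) (px ∷ ps) = let (py , ps′) = pick-All⁻ p ps in py , px ∷ ps′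

  pick-Unique : ∀ {y : A} {xs i ys} → Pick xs i y ys → Unique xs → Unique (y ∷ ys)
  pick-Unique here      u        = u
  pick-Unique (there p) (x∉ ∷ u) with pick-Unique p u | pick-All⁻ p x∉
  ... | y∉ ∷ u′ | x≢y , x∉ys = (≢-sym x≢y ∷ y∉) ∷ (x∉ys ∷ u′)

-- The partner of the first entry is removed from `ys`; injectivity keeps it from being the partner
-- of a later one. Distinctness is relative to any `_≈_` because permutations are compared
-- pointwise.
length-≤-injective : {A B : Set} {_≈_ : A → A → Set} (R : A → B → Set) {xs : List A} (ys : List B) →
  (∀ {x x′ y} → R x y → R x′ y → x ≈ x′) →
  AllPairs (λ x x′ → ¬ x ≈ x′) xs → All (λ x → ∃[ y ] y ∈ ys × R x y) xs → length xs ≤ length ys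
length-≤-injective R ys inj []       []                      = z≤n
length-≤-injective R ys inj (x≉ ∷ u) ((y , y∈ys , rxy) ∷ rs) with pick y∈ys
... | i , ys′ , p = subst (suc _ ≤_) (sym (pick-length p))
  (s≤s (length-≤-injective R ys′ inj u (All.zipWith move (x≉ , rs))))
  where
  move : ∀ {x′} → _ × (∃[ y′ ] y′ ∈ ys × R x′ y′) → ∃[ y′ ] y′ ∈ ys′ × R x′ y′
  move (x≉x′ , y′ , y′∈ , r) with pick-∈ p y′∈
  ... | inj₁ refl = contradiction (inj rxy r) x≉x′
  ... | inj₂ y′∈′ = y′ , y′∈′ , r

-- Iterates

module _ {A : Set} (f : A → A) where

  fold-swap : ∀ x i j → fold (fold x f i) f j ≡ fold (fold x f j) f i
  fold-swap x i j = begin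
    fold (fold x f i) f j  ≡⟨ fold-+ x f j ⟨
    fold x f (j + i)       ≡⟨ cong (fold x f) (+-comm j i) ⟩
    fold x f (i + j)       ≡⟨ fold-+ x f i ⟩
    fold (fold x f j) f i  ∎
    where open ≡-Reasoning

  fold-fixed-* : ∀ {x k} → fold x f k ≡ x → ∀ j → fold x f (j * k) ≡ x
  fold-fixed-* {x} {k} eq zero    = refl
  fold-fixed-* {x} {k} eq (suc j) =
    trans (fold-+ x f k) (trans (cong (λ y → fold y f k) (fold-fixed-* eq j)) eq)

  fold-fixed-∣ : ∀ {x k m} → k ∣ m → fold x f k ≡ x → fold x f m ≡ x
  fold-fixed-∣ (divides j refl) eq = fold-fixed-* eq j

  least⇒∣ : ∀ {x k m} .{{_ : NonZero k}} → (∀ {i} → 0 < i → i < k → fold x f i ≢ x) →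
            fold x f k ≡ x → fold x f m ≡ x → k ∣ m
  least⇒∣ {x} {k} {m} least fixₖ fixₘ with m % k in eq
  ... | zero  = m%n≡0⇒n∣m m k eq
  ... | suc r = contradiction fixᵣ (least z<s (subst (_< k) eq (m%n<n m k)))
    where
    open ≡-Reasoning
    fixᵣ : fold x f (suc r) ≡ x
    fixᵣ = begin
      fold x f (suc r)                   ≡⟨ cong (fold x f) eq ⟨
      fold x f (m % k)                   ≡⟨ cong (λ y → fold y f (m % k)) (fold-fixed-* fixₖ (m / k)) ⟨
      fold (fold x f (m / k * k)) f (m % k) ≡⟨ fold-+ x f (m % k) ⟨
      fold x f (m % k + m / k * k)       ≡⟨ cong (fold x f) (m≡m%n+[m/n]*n m k) ⟨
      fold x f m                         ≡⟨ fixₘ ⟩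
      x                                  ∎

  fold-injective : Injective _≡_ _≡_ f → ∀ k {x y} → fold x f k ≡ fold y f k → x ≡ y
  fold-injective inj zero    eq = eq
  fold-injective inj (suc k) eq = fold-injective inj k (inj eq)

-- For injective `f` on a finite set this is the length of the cycle through `x`. Minimality takes
-- the form of divisibility, which is how it is used.
record Order {A : Set} (f : A → A) (x : A) : Set where
  field
    order   : ℕ
    order≢0 : NonZero order
    fixed   : fold x f order ≡ x
    order∣  : ∀ {m} → fold x f m ≡ x → order ∣ m

  ∣⇒fixed : ∀ {m} → order ∣ m → fold x f m ≡ x
  ∣⇒fixed d = fold-fixed-∣ f d fixed

open Order

fold⇒Order : ∀ {n} (f : Fin n → Fin n) {x} k .{{_ : NonZero k}} → fold x f k ≡ x → Order f x
fold⇒Order f {x} = <-rec _ go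
  where
  go : ∀ k → (∀ {i} → i < k → .{{_ : NonZero i}} → fold x f i ≡ x → Order f x) →
       .{{_ : NonZero k}} → fold x f k ≡ x → Order f x
  go k rec fix with anyUpTo? (λ i → (0 <? i) ×-dec (fold x f i ≟ x)) k
  ... | yes (i , i<k , 0<i , fixᵢ) = rec i<k {{>-nonZero 0<i}} fixᵢ
  ... | no none = record
    { order   = k
    ; order≢0 = recompute-nonZero
    ; fixed   = fix
    ; order∣  = least⇒∣ f (λ 0<i i<k fixᵢ → none (_ , i<k , 0<i , fixᵢ)) fix
    }
    where
    recompute-nonZero : NonZero k
    recompute-nonZero = >-nonZero (>-nonZero⁻¹ k)

abstract
  -- Two of the first `n + 1` iterates agree, and injectivity strips their common initial part,
  -- leaving a positive period.
  injective⇒Order : ∀ {n} {f : Fin n → Fin n} → Injective _≡_ _≡_ f → ∀ x → Order f x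
  injective⇒Order {n} {f} inj x with pigeonhole ≤-refl (λ (i : Fin (suc n)) → fold x f (toℕ i))
  ... | i , j , i<j , eq with k , refl′ ← m≤n⇒∃[o]m+o≡n i<j = fold⇒Order f (suc k)
    (sym (fold-injective f inj (toℕ i) (trans eq (begin
      fold x f (toℕ j)                 ≡⟨ cong (fold x f) refl′ ⟨
      fold x f (suc (toℕ i) + k)       ≡⟨ cong (fold x f) (+-suc (toℕ i) k) ⟨
      fold x f (toℕ i + suc k)         ≡⟨ fold-+ x f (toℕ i) ⟩
      fold (fold x f (suc k)) f (toℕ i) ∎))))
    where open ≡-Reasoning

-- Cycle codes

Code : Set
Code = List ℕ

data Start {A : Set} (f : A → A) : List A → Code → Set
data Open {A : Set} (f : A → A) (a : A) : A → List A → Code → Set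

-- The permutation is exposed one image at a time.  In Open f a x rem e the
-- current cycle began at a and has reached x, the images not yet used are
-- a ∷ rem, and the first digit of e is the position of f x among them; hence
-- the digit 0 closes the cycle, and the next one begins at the head of rem.
data Start f where
  done  : Start f [] []
  start : ∀ {a rem e} → Open f a a rem e → Start f (a ∷ rem) e

data Open f a where
  close : ∀ {x rem e} → f x ≡ a → Start f rem e → Open f a x rem (0 ∷ e)
  move  : ∀ {x y rem rem′ i e} → Pick rem i y rem′ → f x ≡ y → Open f a y rem′ e →
          Open f a x rem (suc i ∷ e)

module _ {A : Set} {f : A → A} (inj : Injective _≡_ _≡_ f) where

  encode : ∀ m {rem} → length rem ≡ m → Unique rem → (∀ {v} → v ∈ rem → f v ∈ rem) → ∃[ e ] Start f rem e
  encodeOpen : ∀ m {a x rem} → length rem ≡ m → Unique (a ∷ rem) → Unique (x ∷ rem) →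
               (∀ {v} → v ∈ x ∷ rem → f v ∈ a ∷ rem) → ∃[ e ] Open f a x rem e

  encode zero    {[]}      _    _ _      = [] , done
  encode (suc m) {a ∷ rem} refl u closed = let (e , o) = encodeOpen m refl u u closed in e , start o

  encodeOpen m {a} {x} {rem} eq (a∉ ∷ u) (x∉ ∷ _) closed with closed (here refl)
  ... | here fx≡a = let (e , s) = encode m eq u closed′ in 0 ∷ e , close fx≡a s
    where
    closed′ : ∀ {v} → v ∈ rem → f v ∈ rem
    closed′ v∈ with closed (there v∈)
    ... | here fv≡a = contradiction (inj (trans fx≡a (sym fv≡a))) (All.lookup x∉ v∈)
    ... | there fv∈ = fv∈
  encodeOpen zero    {rem = []} _  _ _ _ | there ()
  encodeOpen (suc m) {a} {x} {rem} eq (a∉ ∷ u) (x∉ ∷ _) closed | there fx∈ with pick fx∈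
  ... | i , rem′ , p with pick-Unique p u
  ... | y∉ ∷ u′ =
    let (e , o) = encodeOpen m (suc-injective (trans (sym (pick-length p)) eq))
                    (proj₂ (pick-All⁻ p a∉) ∷ u′) (y∉ ∷ u′) closed′
    in suc i ∷ e , move p refl o
    where
    stays : ∀ {v} → x ≢ v → f v ∈ a ∷ rem → f v ∈ a ∷ rem′
    stays x≢v (here eq) = here eq
    stays x≢v (there fv∈) with pick-∈ p fv∈
    ... | inj₁ fv≡fx = contradiction (sym (inj fv≡fx)) x≢v
    ... | inj₂ fv∈′  = there fv∈′
    unpick : ∀ {v} → v ∈ f x ∷ rem′ → v ∈ rem
    unpick = unpick-∈ p
      where
      unpick-∈ : ∀ {xs i y ys} {v : A} → Pick xs i y ys → v ∈ y ∷ ys → v ∈ xs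
      unpick-∈ here      v∈                 = v∈
      unpick-∈ (there p) (here eq)          = there (unpick-∈ p (here eq))
      unpick-∈ (there p) (there (here eq))  = here eq
      unpick-∈ (there p) (there (there v∈)) = there (unpick-∈ p (there v∈))
    closed′ : ∀ {v} → v ∈ f x ∷ rem′ → f v ∈ a ∷ rem′
    closed′ v∈ = let v∈rem = unpick v∈ in stays (All.lookup x∉ v∈rem) (closed (there v∈rem))

module _ {A : Set} {f g : A → A} where

  -- Equal digits pick equal images from equal lists, so the two runs stay in step. Hence
  -- permutations can be counted by their codes.
  code-injective : ∀ {rem e} → Start f rem e → Start g rem e → ∀ {v} → v ∈ rem → f v ≡ g v
  open-injective : ∀ {a x rem e} → Open f a x rem e → Open g a x rem e → ∀ {v} → v ∈ x ∷ rem → f v ≡ g v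

  code-injective (start o) (start o′) v∈ = open-injective o o′ v∈

  open-injective (close eq s)  (close eq′ s′) (here refl) = trans eq (sym eq′)
  open-injective (close eq s)  (close eq′ s′) (there v∈)  = code-injective s s′ v∈
  open-injective (move p eq o) (move p′ eq′ o′) v∈ with refl , refl ← pick-deterministic p p′ with v∈
  ... | here refl = trans eq (sym eq′)
  ... | there v∈′ with pick-∈ p v∈′
  ... | inj₁ refl = open-injective o o′ (here refl)
  ... | inj₂ v∈″  = open-injective o o′ (there v∈″)

-- The list splits into cycles, each of whose lengths is a period and so a multiple of `q`. In
-- `goOpen`, `j` steps lead from `a` to `x`, so the cycle has `suc j` elements so far.
∣orders⇒∣length : ∀ {A : Set} {f : A → A} {q} → (∀ x {k} → fold x f k ≡ x → q ∣ k) →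
                  ∀ {rem e} → Start f rem e → q ∣ length rem
∣orders⇒∣length {A} {f} {q} ∣order = go
  where
  go : ∀ {rem e} → Start f rem e → q ∣ length rem
  goOpen : ∀ {a x rem e} j → fold a f j ≡ x → Open f a x rem e → q ∣ suc j + length rem
  go done      = q ∣0
  go (start o) = goOpen 0 refl o
  goOpen {a} j refl (close eq s) = ∣m∣n⇒∣m+n (∣order a eq) (go s)
  goOpen j refl (move {rem′ = rem′} p eq o) =
    subst (q ∣_) (trans (sym (+-suc (suc j) _)) (cong (suc j +_) (sym (pick-length p)))) (goOpen (suc j) eq o)

-- The digit sequences of the factorial number system.
codes : ℕ → List Code
codes zero    = [] ∷ []
codes (suc m) = cartesianProductWith _∷_ (upTo (suc m)) (codes m)

start⇒∈codes : ∀ {A : Set} {f : A → A} {rem e} → Start f rem e → e ∈ codes (length rem)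
open⇒∈codes : ∀ {A : Set} {f : A → A} {a x rem e} → Open f a x rem e → e ∈ codes (suc (length rem))
start⇒∈codes done      = here refl
start⇒∈codes (start o) = open⇒∈codes o
open⇒∈codes {rem = rem} (close _ s) =
  ∈-cartesianProductWith⁺ _∷_ (∈-upTo⁺ {suc (length rem)} z<s) (start⇒∈codes s)
open⇒∈codes (move {e = e} p _ o) = ∈-cartesianProductWith⁺ _∷_ (∈-upTo⁺ (s<s (pick-< p)))
  (subst (λ l → e ∈ codes l) (sym (pick-length p)) (open⇒∈codes o))

-- The codes whose current cycle, having k elements when m other images are
-- left, closes with c elements and r images left, and continues in Ψ c r.
cycleCodes : (ℕ → ℕ → List Code) → ℕ → ℕ → List Code
cycleCodes Ψ k zero    = map (0 ∷_) (Ψ k zero)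
cycleCodes Ψ k (suc m) =
  map (0 ∷_) (Ψ k (suc m)) ++ cartesianProductWith _∷_ (map suc (upTo (suc m))) (cycleCodes Ψ (suc k) m)

-- The outcome of following a cycle begun at `a`, with `k` elements known, until it closes.
-- `∈cycleCodes` holds for every `Ψ`, so that one exposure serves both families of codes counted
-- later.
record Exposure {A : Set} (f : A → A) (a : A) (k : ℕ) (rem : List A) (e : Code) : Set where
  field
    {cycle}     : ℕ
    {rest}      : List A
    {restCode}  : Code
    cycle≢0     : NonZero cycle
    restRun     : Start f rest restCode
    restUnique  : Unique rest
    total       : cycle + length rest ≡ k + length rem
    cycleFixed  : fold a f cycle ≡ a
    cycleLeast  : ∀ {i} → 0 < i → i < cycle → fold a f i ≢ a
    exhausts    : ∀ {w} → w ∈ rem → w ∈ rest ⊎ (∃[ i ] w ≡ fold a f i)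
    ∈cycleCodes : ∀ Ψ → restCode ∈ Ψ cycle (length rest) → e ∈ cycleCodes Ψ k (length rem)

expose : ∀ {A : Set} {f : A → A} {a x rem e} j → Unique (a ∷ rem) → fold a f j ≡ x →
         (∀ {i} → 0 < i → i < suc j → fold a f i ≢ a) → Open f a x rem e → Exposure f a (suc j) rem e
expose {f = f} {a} j (_ ∷ u) refl least (close {rem = rem} {e} eq s) = record
  { cycle≢0     = _
  ; restRun     = s
  ; restUnique  = u
  ; total       = refl
  ; cycleFixed  = eq
  ; cycleLeast  = least
  ; exhausts    = inj₁
  ; ∈cycleCodes = λ Ψ e∈ → closing Ψ (length rem) e∈
  }
  where
  closing : ∀ Ψ r → e ∈ Ψ (suc j) r → 0 ∷ e ∈ cycleCodes Ψ (suc j) r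
  closing Ψ zero    e∈ = ∈-map⁺ (0 ∷_) e∈
  closing Ψ (suc r) e∈ = ∈-++⁺ˡ (∈-map⁺ (0 ∷_) e∈)
expose {f = f} {a} {rem = rem} j (a∉ ∷ u) refl least (move {y = y} {rem′ = rem′} {i} {e} p eq o) with pick-Unique p u | pick-All⁻ p a∉
... | y∉ ∷ u′ | a≢y , a∉′ = record
  { cycle≢0     = cycle≢0
  ; restRun     = restRun
  ; restUnique  = restUnique
  ; total       = trans total (trans (sym (+-suc (suc j) _)) (cong (suc j +_) (sym (pick-length p))))
  ; cycleFixed  = cycleFixed
  ; cycleLeast  = cycleLeast
  ; exhausts    = λ w∈ → [ (λ { refl → inj₂ (suc j , sym eq) }) , exhausts ]′ (pick-∈ p w∈)
  ; ∈cycleCodes = λ Ψ e′∈ → subst (λ l → suc i ∷ e ∈ cycleCodes Ψ (suc j) l) (sym (pick-length p))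
      (∈-++⁺ʳ (map (0 ∷_) (Ψ (suc j) (suc (length rem′)))) (∈-cartesianProductWith⁺ _∷_
        (∈-map⁺ suc (∈-upTo⁺ (subst (i <_) (pick-length p) (pick-< p)))) (∈cycleCodes Ψ e′∈)))
  }
  where
  least′ : ∀ {i} → 0 < i → i < suc (suc j) → fold a f i ≢ a
  least′ {i} 0<i i<2+j with m<1+n⇒m<n∨m≡n i<2+j
  ... | inj₁ i<1+j = least 0<i i<1+j
  -- The point just reached was picked from a list that does not contain `a`.
  ... | inj₂ refl  = λ fix → a≢y (trans (sym fix) eq)
  open Exposure (expose (suc j) (a∉′ ∷ u′) eq least′ o)

-- Autoparatopisms

⟨$⟩ʳ-injective : ∀ {n} (π : Permutation′ n) → Injective _≡_ _≡_ (π ⟨$⟩ʳ_)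
⟨$⟩ʳ-injective π = Injection.injective (↔⇒↣ π)

∣orders⇒∣n : ∀ {n} {f : Fin n → Fin n} {q} → Injective _≡_ _≡_ f → (∀ x {k} → fold x f k ≡ x → q ∣ k) → q ∣ n
∣orders⇒∣n {n} {f} {q} inj ∣order = subst (q ∣_) (length-tabulate {n = n} (λ i → i))
  (∣orders⇒∣length ∣order (proj₂ (encode inj _ refl (allFin⁺ n) λ _ → ∈-allFin _)))

-- An injection into two tagged copies of `xs`: following `half w`, `w` goes to `w` in the first
-- copy or to `f w` in the second.
n≤2*length : ∀ {n} {S : Fin n → Set} (f : Fin n → Fin n) → Injective _≡_ _≡_ f →
  (∀ w → S w ⊎ S (f w)) → (xs : List (Fin n)) → (∀ {w} → S w → w ∈ xs) → n ≤ 2 * length xs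
n≤2*length {n} {S} f inj half xs S⊆xs = subst₂ _≤_ (length-tabulate {n = n} (λ i → i)) length-ys
  (length-≤-injective R ys R-injective (allFin⁺ n) (All.tabulate λ {w} _ → [ left w , right w ]′ (half w)))
  where
  ys : List (Fin n ⊎ Fin n)
  ys = map inj₁ xs ++ map inj₂ xs

  R : Fin n → Fin n ⊎ Fin n → Set
  R w (inj₁ v) = w ≡ v
  R w (inj₂ v) = f w ≡ v

  R-injective : ∀ {w w′ y} → R w y → R w′ y → w ≡ w′
  R-injective {y = inj₁ _} eq eq′ = trans eq (sym eq′)
  R-injective {y = inj₂ _} eq eq′ = inj (trans eq (sym eq′))

  left : ∀ w → S w → ∃[ y ] y ∈ ys × R w y
  left w s = inj₁ w , ∈-++⁺ˡ (∈-map⁺ inj₁ (S⊆xs s)) , refl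

  right : ∀ w → S (f w) → ∃[ y ] y ∈ ys × R w y
  right w s = inj₂ (f w) , ∈-++⁺ʳ (map inj₁ xs) (∈-map⁺ inj₂ (S⊆xs s)) , refl

  length-ys : length ys ≡ 2 * length xs
  length-ys = trans (length-++ (map inj₁ xs))
    (cong₂ _+_ (length-map inj₁ xs) (trans (length-map inj₂ xs) (sym (+-identityʳ _))))

module Autoparatopism {n : ℕ} (L : LatinSquare n) (α β γ : Permutation′ n)
                      (auto : IsAutoparatopism L (paratopism₁₂ α β γ)) where

  open IsLatin (latin L)

  infixl 7 _·_
  _·_ : Fin n → Fin n → Fin n
  x · y = entry (array L) x y

  -- The components αβ, βα and γ² of σ², acting on rows, columns and symbols.
  A B G : Fin n → Fin n
  A x = β ⟨$⟩ʳ (α ⟨$⟩ʳ x)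
  B y = α ⟨$⟩ʳ (β ⟨$⟩ʳ y)
  G z = γ ⟨$⟩ʳ (γ ⟨$⟩ʳ z)

  ·-cancelˡ : ∀ x {y y′} → x · y ≡ x · y′ → y ≡ y′
  ·-cancelˡ x {y} {y′} eq = let (_ , _ , unique) = row x (x · y′) in trans (sym (unique eq)) (unique refl)

  ·-cancelʳ : ∀ y {x x′} → x · y ≡ x′ · y → x ≡ x′
  ·-cancelʳ y {x} {x′} eq = let (_ , _ , unique) = column y (x′ · y) in trans (sym (unique eq)) (unique refl)

  infixl 7 _\\_
  _\\_ : Fin n → Fin n → Fin n
  x \\ z = proj₁ (row x z)

  ·-\\ : ∀ x z → x · (x \\ z) ≡ z
  ·-\\ x z = proj₁ (proj₂ (row x z))

  γ-· : ∀ x y → (β ⟨$⟩ʳ y) · (α ⟨$⟩ʳ x) ≡ γ ⟨$⟩ʳ (x · y)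
  γ-· x y = proj₁ auto (x , y , x · y , refl , refl)

  G-· : ∀ x y → A x · B y ≡ G (x · y)
  G-· x y = trans (γ-· _ _) (cong (γ ⟨$⟩ʳ_) (γ-· x y))

  fold-· : ∀ x y k → fold x A k · fold y B k ≡ fold (x · y) G k
  fold-· x y zero    = refl
  fold-· x y (suc k) = trans (G-· _ _) (cong G (fold-· x y k))

  -- This conjugacy gives `A` at `x` and `B` at the image of `x` under `α` the same cycle length.
  α-fold : ∀ x k → α ⟨$⟩ʳ fold x A k ≡ fold (α ⟨$⟩ʳ x) B k
  α-fold x zero    = refl
  α-fold x (suc k) = cong B (α-fold x k)

  fold-G : ∀ z k → fold z G k ≡ fold z (γ ⟨$⟩ʳ_) (k * 2)
  fold-G z zero    = refl
  fold-G z (suc k) = cong G (fold-G z k)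

  A-injective : Injective _≡_ _≡_ A
  A-injective eq = ⟨$⟩ʳ-injective α (⟨$⟩ʳ-injective β eq)

  orderA : ∀ x → Order A x
  orderA = injective⇒Order A-injective

  orderB : ∀ y → Order B y
  orderB = injective⇒Order λ eq → ⟨$⟩ʳ-injective β (⟨$⟩ʳ-injective α eq)

  orderG : ∀ z → Order G z
  orderG = injective⇒Order λ eq → ⟨$⟩ʳ-injective γ (⟨$⟩ʳ-injective γ eq)

  orderG∣lcm : ∀ x y → order (orderG (x · y)) ∣ lcm (order (orderA x)) (order (orderB y))
  orderG∣lcm x y = order∣ (orderG (x · y)) (trans (sym (fold-· x y l))
    (cong₂ _·_ (∣⇒fixed (orderA x) (m∣lcm[m,n] a _))
               (∣⇒fixed (orderB y) (n∣lcm[m,n] a _))))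
    where
    a = order (orderA x)
    l = lcm a (order (orderB y))

  -- A common period of a row and a symbol also fixes the column, because the symbol occurs only
  -- once in that row.
  orderB∣lcm : ∀ x y → order (orderB y) ∣ lcm (order (orderA x)) (order (orderG (x · y)))
  orderB∣lcm x y = order∣ (orderB y) (·-cancelˡ x (begin
    x · fold y B l           ≡⟨ cong (_· fold y B l) (∣⇒fixed (orderA x) (m∣lcm[m,n] a _)) ⟨
    fold x A l · fold y B l  ≡⟨ fold-· x y l ⟩
    fold (x · y) G l         ≡⟨ ∣⇒fixed (orderG (x · y)) (n∣lcm[m,n] a _) ⟩
    x · y                    ∎))
    where
    open ≡-Reasoning
    a = order (orderA x)
    l = lcm a (order (orderG (x · y)))

  orderB-α : ∀ x → order (orderA x) ∣ order (orderB (α ⟨$⟩ʳ x))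
  orderB-α x = order∣ (orderA x) (⟨$⟩ʳ-injective α (trans (α-fold x (order (orderB (α ⟨$⟩ʳ x)))) (fixed (orderB (α ⟨$⟩ʳ x)))))

  module _ {p : ℕ} (pp : Prime p) (v : ℕ) where

    private
      q = p ^ v

    -- Let q ∤ order x₀ and q ∣ order z.  In row x₀ the symbols of order
    -- divisible by q are those in the columns of order divisible by q; and z
    -- occurs in each row of order not divisible by q, in a column of order
    -- divisible by q.
    swapSymbols : Fin n → Fin n → Fin n → Fin n
    swapSymbols x₀ z w = x₀ · ((α ⟨$⟩ˡ (x₀ \\ w)) \\ z)

    -- The resulting symbol determines its column in row `x₀`; that column determines the row
    -- containing `z`, whose image under `α` is the column of `w` in row `x₀`.
    swapSymbols-injective : ∀ x₀ z → Injective _≡_ _≡_ (swapSymbols x₀ z)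
    swapSymbols-injective x₀ z {w} {w′} eq = trans (sym (·-\\ x₀ w)) (trans (cong (x₀ ·_) x₀\\w≡) (·-\\ x₀ w′))
      where
      x x′ : Fin n
      x  = α ⟨$⟩ˡ (x₀ \\ w)
      x′ = α ⟨$⟩ˡ (x₀ \\ w′)
      x≡x′ : x ≡ x′
      x≡x′ = ·-cancelʳ (x \\ z) (trans (·-\\ x z) (sym (trans (cong (x′ ·_) (·-cancelˡ x₀ eq)) (·-\\ x′ z))))
      x₀\\w≡ : x₀ \\ w ≡ x₀ \\ w′
      x₀\\w≡ = trans (sym (inverseʳ α)) (trans (cong (α ⟨$⟩ʳ_) x≡x′) (inverseʳ α))

    -- Row `x₀` and symbol `w` give `q ∤ y`, and conjugacy gives `q ∤ x`. Then the symbol `z` in row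
    -- `x` forces `q` to divide the order of column `y′`, and row `x₀` passes this on to `w′`.
    swapSymbols-∣ : ∀ {x₀ z} → q ∤ order (orderA x₀) → q ∣ order (orderG z) → ∀ w → q ∤ order (orderG w) →
                    q ∣ order (orderG (swapSymbols x₀ z w))
    swapSymbols-∣ {x₀} {z} q∤x₀ q∣z w q∤w = q∣w′
      where
      y x y′ w′ : Fin n
      y  = x₀ \\ w
      x  = α ⟨$⟩ˡ y
      y′ = x \\ z
      w′ = x₀ · y′

      or : ∀ {a b c} → NonZero a → NonZero b → c ∣ lcm a b → q ∣ c → q ∣ a ⊎ q ∣ b
      or a≢0 b≢0 c∣ q∣c = primePower∣lcm pp v _ _ {{a≢0}} {{b≢0}} (∣-trans q∣c c∣)

      q∤y : q ∤ order (orderB y)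
      q∤y q∣y with or (order≢0 (orderA x₀)) (order≢0 (orderG (x₀ · y))) (orderB∣lcm x₀ y) q∣y
      ... | inj₁ q∣x₀ = q∤x₀ q∣x₀
      ... | inj₂ q∣w  = q∤w (subst (λ w → q ∣ order (orderG w)) (·-\\ x₀ w) q∣w)

      q∤x : q ∤ order (orderA x)
      q∤x q∣x = q∤y (subst (λ y → q ∣ order (orderB y)) (inverseʳ α) (∣-trans q∣x (orderB-α x)))

      q∣y′ : q ∣ order (orderB y′)
      q∣y′ with or (order≢0 (orderA x)) (order≢0 (orderB y′)) (orderG∣lcm x y′)
                   (subst (λ z → q ∣ order (orderG z)) (sym (·-\\ x z)) q∣z)
      ... | inj₁ q∣x = contradiction q∣x q∤x
      ... | inj₂ q∣y = q∣y

      q∣w′ : q ∣ order (orderG w′)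
      q∣w′ with or (order≢0 (orderA x₀)) (order≢0 (orderG w′)) (orderB∣lcm x₀ y′) q∣y′
      ... | inj₁ q∣x₀ = contradiction q∣x₀ q∤x₀
      ... | inj₂ q∣w  = q∣w

    -- In use, `xs` holds the points not yet exposed and `M` is the product of the exposed cycle
    -- lengths.
    primePower∣n*M : ∀ {M} (xs : List (Fin n)) → 2 * length xs < n →
      (∀ w → w ∈ xs ⊎ fold w (γ ⟨$⟩ʳ_) M ≡ w) → ∀ z → q ∣ order (orderG z) → q ∣ n * M
    primePower∣n*M {M} xs few covered z q∣z with all? (λ x → q ∣? order (orderA x))
    ... | yes q∣A = ∣m⇒∣m*n M (∣orders⇒∣n A-injective λ x fix → ∣-trans (q∣A x) (order∣ (orderA x) fix))
    ... | no ¬q∣A with ¬∀⟶∃¬ n _ (λ x → q ∣? order (orderA x)) ¬q∣A | q ∣? M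
    ... | x₀ , q∤x₀ | yes q∣M = ∣n⇒∣m*n n q∣M
    -- Since `q ∤ M`, all symbols of order divisible by `q` lie in `xs`; but they make up at least
    -- half of the symbols.
    ... | x₀ , q∤x₀ | no q∤M = contradiction
      (n≤2*length {S = λ w → q ∣ order (orderG w)} (swapSymbols x₀ z) (swapSymbols-injective x₀ z) half xs inside)
      (<⇒≱ few)
      where
      half : ∀ w → q ∣ order (orderG w) ⊎ q ∣ order (orderG (swapSymbols x₀ z w))
      half w with q ∣? order (orderG w)
      ... | yes q∣w = inj₁ q∣w
      ... | no q∤w  = inj₂ (swapSymbols-∣ q∤x₀ q∣z w q∤w)

      inside : ∀ {w} → q ∣ order (orderG w) → w ∈ xs
      inside {w} q∣w with covered w
      ... | inj₁ w∈ = w∈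
      ... | inj₂ fix = contradiction (∣-trans q∣w (order∣ (orderG w)
        (trans (fold-G w M) (fold-fixed-∣ (γ ⟨$⟩ʳ_) (m∣m*n {M} 2) fix)))) q∤M

  -- Every prime power dividing the order of `z` under γ² divides `n * M`, so the order does too.
  -- The factor 2 passes from γ² to γ.
  γ-fixed : ∀ {M} (xs : List (Fin n)) → 2 * length xs < n →
    (∀ w → w ∈ xs ⊎ fold w (γ ⟨$⟩ʳ_) M ≡ w) → ∀ z → fold z (γ ⟨$⟩ʳ_) (2 * n * M) ≡ z
  γ-fixed {M} xs few covered z = trans (cong (fold z (γ ⟨$⟩ʳ_)) (rearrange n M)) (trans (sym (fold-G z (n * M)))
    (∣⇒fixed (orderG z) (primePowers∣⇒∣ (order (orderG z)) {{order≢0 (orderG z)}}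
      λ v pp q∣z → primePower∣n*M pp v xs few covered z q∣z)))
    where
    rearrange : ∀ n M → 2 * n * M ≡ n * M * 2
    rearrange = solve-∀

-- Counting codes

indicator : {P : Set} → Dec P → ℕ
indicator (yes _) = 1
indicator (no _)  = 0

onlyIf : {P A : Set} → Dec P → List A → List A
onlyIf (yes _) xs = xs
onlyIf (no _)  xs = []

length-codes : ∀ m → length (codes m) ≡ m !
length-codes zero    = refl
length-codes (suc m) = trans (length-cartesianProductWith _∷_ (upTo (suc m)) (codes m))
  (cong₂ _*_ (length-upTo (suc m)) (length-codes m))

length-cycleCodes : ∀ Ψ k m → length (cycleCodes Ψ k (suc m)) ≡ length (Ψ k (suc m)) + suc m * length (cycleCodes Ψ (suc k) m)
length-cycleCodes Ψ k m = trans (length-++ (map (0 ∷_) (Ψ k (suc m)))) (cong₂ _+_ (length-map (0 ∷_) (Ψ k (suc m)))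
  (trans (length-cartesianProductWith _∷_ (map suc (upTo (suc m))) (cycleCodes Ψ (suc k) m))
    (cong (_* length (cycleCodes Ψ (suc k) m)) (trans (length-map suc (upTo (suc m))) (length-upTo (suc m))))))

-- The sum of `w c r` over `c` from `k` to `k + m`, the possible final lengths of the current cycle,
-- with `r = k + m - c`.
sumCycles : (ℕ → ℕ → ℕ) → ℕ → ℕ → ℕ
sumCycles w k zero    = w k zero
sumCycles w k (suc m) = w k (suc m) + sumCycles w (suc k) m

-- The length of a cycle of a random permutation is uniformly distributed.
length-cycleCodes-≤ : ∀ {Ψ} S w k m .{{_ : NonZero k}} →
  (∀ c r → .{{NonZero c}} → c + r ≡ k + m → S * length (Ψ c r) ≤ r ! * w c r) →
  S * length (cycleCodes Ψ k m) ≤ m ! * sumCycles w k m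
length-cycleCodes-≤ {Ψ} S w k zero bound =
  subst (λ l → S * l ≤ 1 * w k 0) (sym (length-map (0 ∷_) (Ψ k 0))) (bound k 0 refl)
length-cycleCodes-≤ {Ψ} S w k (suc m) bound = begin
  S * length (cycleCodes Ψ k (suc m))  ≡⟨ cong (S *_) (length-cycleCodes Ψ k m) ⟩
  S * (l + suc m * l′)                 ≡⟨ expand S l (suc m) l′ ⟩
  S * l + suc m * (S * l′)             ≤⟨ +-mono-≤ (bound k (suc m) refl) (*-monoʳ-≤ (suc m)
    (length-cycleCodes-≤ S w (suc k) m λ c r eq → bound c r (trans eq (sym (+-suc k m))))) ⟩
  (suc m) ! * w k (suc m) + suc m * (m ! * sumCycles w (suc k) m)
                                       ≡⟨ collect (suc m) (m !) (w k (suc m)) (sumCycles w (suc k) m) ⟩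
  (suc m) ! * (w k (suc m) + sumCycles w (suc k) m) ∎
  where
  open ≤-Reasoning
  l  = length (Ψ k (suc m))
  l′ = length (cycleCodes Ψ (suc k) m)
  expand : ∀ a b c d → a * (b + c * d) ≡ a * b + c * (a * d)
  expand = solve-∀
  collect : ∀ a b c d → a * b * c + a * (b * d) ≡ a * b * (c + d)
  collect = solve-∀

sumCycles-≤ : ∀ {w w′} → (∀ c r → w c r ≤ w′ r) → ∀ k m → sumCycles w k m ≤ sumCycles (λ _ → w′) k m
sumCycles-≤ h k zero    = h k 0
sumCycles-≤ h k (suc m) = +-mono-≤ (h k (suc m)) (sumCycles-≤ h (suc k) m)

sumCycles-const : ∀ b k m → sumCycles (λ _ _ → b) k m ≡ b * suc m
sumCycles-const b k zero    = sym (*-identityʳ b)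
sumCycles-const b k (suc m) = trans (cong (b +_) (sumCycles-const b (suc k) m)) (sym (*-suc b (suc m)))

sumCycles-linear : ∀ k m → sumCycles (λ _ r → 2 * r) k m ≡ m * suc m
sumCycles-linear k zero    = refl
sumCycles-linear k (suc m) = trans (cong (2 * suc m +_) (sumCycles-linear (suc k) m)) (rearrange m)
  where
  rearrange : ∀ m → 2 * (1 + m) + m * (1 + m) ≡ (1 + m) * (2 + m)
  rearrange = solve-∀

below : ℕ → ℕ → ℕ
below T r = indicator (r <? T)

below-≤1 : ∀ T r → below T r ≤ 1
below-≤1 T r with r <? T
... | yes _ = ≤-refl
... | no _  = z≤n

-- At most `T` terms have `r < T`. As `r` decreases along the sum, either all terms are of this kind
-- or the first is not and splits off.
sumCycles-below : ∀ b s T k m → sumCycles (λ _ r → b + s * below T r) k m ≤ b * suc m + s * T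
sumCycles-below b s T k zero with 0 <? T
... | yes 0<T = +-mono-≤ (≤-reflexive (sym (*-identityʳ b))) (*-monoʳ-≤ s 0<T)
... | no _    = +-mono-≤ (≤-reflexive (sym (*-identityʳ b))) (*-monoʳ-≤ s z≤n)
sumCycles-below b s T k (suc m) with suc m <? T
... | yes m<T = begin
  b + s * 1 + sumCycles (λ _ r → b + s * below T r) (suc k) m
    ≤⟨ +-monoʳ-≤ _ (sumCycles-≤ (λ _ r → +-monoʳ-≤ b (*-monoʳ-≤ s (below-≤1 T r))) (suc k) m) ⟩
  b + s * 1 + sumCycles (λ _ _ → b + s * 1) (suc k) m
    ≡⟨ cong (b + s * 1 +_) (sumCycles-const (b + s * 1) (suc k) m) ⟩
  b + s * 1 + (b + s * 1) * suc m  ≡⟨ rearrange b s m ⟩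
  b * (2+ m) + s * (2+ m)          ≤⟨ +-monoʳ-≤ (b * (2+ m)) (*-monoʳ-≤ s m<T) ⟩
  b * (2+ m) + s * T               ∎
  where
  open ≤-Reasoning
  rearrange : ∀ b s m → b + s * 1 + (b + s * 1) * (1 + m) ≡ b * (2 + m) + s * (2 + m)
  rearrange = solve-∀
... | no _ = begin
  b + s * 0 + sumCycles (λ _ r → b + s * below T r) (suc k) m
    ≤⟨ +-monoʳ-≤ _ (sumCycles-below b s T (suc k) m) ⟩
  b + s * 0 + (b * suc m + s * T)  ≡⟨ rearrange b s m T ⟩
  b * (2+ m) + s * T               ∎
  where
  open ≤-Reasoning
  rearrange : ∀ b s m T → b + s * 0 + (b * (1 + m) + s * T) ≡ b * (2 + m) + s * T
  rearrange = solve-∀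

divisorIndicator : ℕ → ℕ → ℕ
divisorIndicator M c = indicator (c ∣? M)

-- Each divisor met is removed from `ds`. The restriction `k ≤ c` permits this, as later terms
-- concern larger `c` only.
sumCycles-divisors : ∀ {M} k m ds → (∀ {c} → k ≤ c → c ∣ M → c ∈ ds) →
  sumCycles (λ c _ → divisorIndicator M c) k m ≤ length ds
sumCycles-divisors {M} k zero ds cover with k ∣? M
... | no _ = z≤n
... | yes k∣M with pick (cover ≤-refl k∣M)
...   | _ , _ , p = subst (1 ≤_) (sym (pick-length p)) (s≤s z≤n)
sumCycles-divisors {M} k (suc m) ds cover with k ∣? M
... | no _ = sumCycles-divisors (suc k) m ds λ k<c → cover (<⇒≤ k<c)
... | yes k∣M with pick (cover ≤-refl k∣M)
...   | _ , ds′ , p = subst (suc _ ≤_) (sym (pick-length p))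
  (s≤s (sumCycles-divisors (suc k) m ds′ λ k<c c∣M →
    [ (λ { refl → contradiction k<c (n≮n k) }) , (λ c∈ → c∈) ]′ (pick-∈ p (cover (<⇒≤ k<c) c∣M))))

-- The codes in which, after J cycles, no image is left or the length of the
-- next cycle divides M times the product of the lengths of these J cycles.
dividingCodes : ℕ → ℕ → ℕ → List Code
dividingCodes J       M zero    = [] ∷ []
dividingCodes zero    M (suc m) = cycleCodes (λ c r → onlyIf (c ∣? M) (codes r)) 1 m
dividingCodes (suc J) M (suc m) = cycleCodes (λ c r → dividingCodes J (M * c) r) 1 m

-- The codes in which, after J cycles, at least n / 2 images are left.
slowCodes : ℕ → ℕ → ℕ → List Code
slowCodes n zero    m       = onlyIf (n ≤? 2 * m) (codes m)
slowCodes n (suc J) zero    = []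
slowCodes n (suc J) (suc m) = cycleCodes (λ _ r → slowCodes n J r) 1 m

-- Markov's inequality: from `m` images, one cycle leaves (m - 1) / 2 on average, so the mean at
-- least halves with each of the `J` cycles.
length-slowCodes : ∀ n J m → n * 2 ^ J * length (slowCodes n J m) ≤ 2 * m * m !
length-slowCodes n zero m with n ≤? 2 * m
... | yes n≤2m = *-mono-≤ (subst (_≤ 2 * m) (sym (*-identityʳ n)) n≤2m) (≤-reflexive (length-codes m))
... | no _     = ≤-trans (≤-reflexive (*-zeroʳ (n * 1))) z≤n
length-slowCodes n (suc J) zero    = ≤-reflexive (*-zeroʳ (n * 2 ^ suc J))
length-slowCodes n (suc J) (suc m) = begin
  n * (2 * 2 ^ J) * l                    ≡⟨ regroup n (2 ^ J) l ⟩
  2 * (n * 2 ^ J * l)                    ≤⟨ *-monoʳ-≤ 2 (length-cycleCodes-≤ (n * 2 ^ J) (λ _ r → 2 * r) 1 m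
    λ c r _ → ≤-trans (length-slowCodes n J r) (≤-reflexive (*-comm (2 * r) (r !)))) ⟩
  2 * (m ! * sumCycles (λ _ r → 2 * r) 1 m) ≡⟨ cong (λ t → 2 * (m ! * t)) (sumCycles-linear 1 m) ⟩
  2 * (m ! * (m * suc m))                ≤⟨ *-monoʳ-≤ 2 (*-monoʳ-≤ (m !) (*-monoˡ-≤ (suc m) (n≤1+n m))) ⟩
  2 * (m ! * (suc m * suc m))            ≡⟨ regroup′ (m !) (suc m) ⟩
  2 * suc m * (suc m) !                  ∎
  where
  open ≤-Reasoning
  l = length (cycleCodes (λ _ r → slowCodes n J r) 1 m)
  regroup : ∀ a b c → a * (2 * b) * c ≡ 2 * (a * b * c)
  regroup = solve-∀
  regroup′ : ∀ a b → 2 * (a * (b * b)) ≡ 2 * b * (b * a)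
  regroup′ = solve-∀

length-dividingCodes-≤! : ∀ J M m → length (dividingCodes J M m) ≤ m !
length-dividingCodes-≤! J M zero = ≤-refl
length-dividingCodes-≤! J M (suc m) = begin
  length (dividingCodes J M (suc m))      ≡⟨ +-identityʳ _ ⟨
  1 * length (dividingCodes J M (suc m))  ≤⟨ go J ⟩
  m ! * sumCycles (λ _ _ → 1) 1 m         ≡⟨ cong (m ! *_) (trans (sumCycles-const 1 1 m) (+-identityʳ _)) ⟩
  m ! * suc m                             ≡⟨ *-comm (m !) (suc m) ⟩
  (suc m) !                               ∎
  where
  open ≤-Reasoning
  unit : ∀ {l a} → l ≤ a → 1 * l ≤ a * 1
  unit {l} {a} l≤a = subst₂ _≤_ (sym (+-identityʳ l)) (sym (*-identityʳ a)) l≤a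
  select : ∀ c r → length (onlyIf (c ∣? M) (codes r)) ≤ r !
  select c r with c ∣? M
  ... | yes _ = ≤-reflexive (length-codes r)
  ... | no _  = z≤n
  go : ∀ J → 1 * length (dividingCodes J M (suc m)) ≤ m ! * sumCycles (λ _ _ → 1) 1 m
  go zero    = length-cycleCodes-≤ 1 _ 1 m λ c r _ → unit (select c r)
  go (suc J) = length-cycleCodes-≤ 1 _ 1 m λ c r _ → unit (length-dividingCodes-≤! J (M * c) r)

module Dividing (n s D X : ℕ) (s≢0 : NonZero s) (D≢0 : NonZero D)
  (few : ∀ M m → .{{NonZero M}} → M ≤ X → sumCycles (λ c _ → divisorIndicator M c) 1 m ≤ D) where

  private instance
    _ = s≢0
    _ = D≢0

  -- With `threshold (suc J)` images left, the next cycle leaves fewer than `threshold J` with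
  -- probability at most 1 / s; with `s * D` left, its length is one of `D` given values with
  -- probability at most 1 / s.
  threshold : ℕ → ℕ
  threshold zero    = s * D
  threshold (suc J) = s * threshold J

  threshold>0 : ∀ J → 0 < threshold J
  threshold>0 zero    = >-nonZero⁻¹ (s * D) {{m*n≢0 s D}}
  threshold>0 (suc J) = >-nonZero⁻¹ (s * threshold J) {{m*n≢0 s (threshold J) {{s≢0}} {{>-nonZero (threshold>0 J)}}}}

  -- A union bound over `J + 1` failures of probability at most 1 / s each. As cycles have length at
  -- most `n`, `M * n ^ J ≤ X` keeps the final multiple within the range of `few`.
  length-dividingCodes : ∀ J M m .{{_ : NonZero M}} → M * n ^ J ≤ X → m ≤ n → threshold J ≤ m →
    s * length (dividingCodes J M m) ≤ suc J * m !
  length-dividingCodes J M zero _ _ T≤0 = contradiction (≤-trans (threshold>0 J) T≤0) λ ()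
  length-dividingCodes zero M (suc m) M≤X m<n T≤m = begin
    s * l                                                ≤⟨ *-monoʳ-≤ s (begin
      l        ≡⟨ +-identityʳ l ⟨
      1 * l    ≤⟨ length-cycleCodes-≤ 1 (λ c _ → divisorIndicator M c) 1 m (λ c r _ → select c r) ⟩
      m ! * sumCycles (λ c _ → divisorIndicator M c) 1 m
               ≤⟨ *-monoʳ-≤ (m !) (few M m (subst (_≤ X) (*-identityʳ M) M≤X)) ⟩
      m ! * D  ∎) ⟩
    s * (m ! * D)                                        ≡⟨ rearrange s (m !) D ⟩
    m ! * (s * D)                                        ≤⟨ *-monoʳ-≤ (m !) T≤m ⟩
    m ! * suc m                                          ≡⟨ *-comm (m !) (suc m) ⟩
    (suc m) !                                            ≡⟨ +-identityʳ _ ⟨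
    1 * (suc m) !                                        ∎
    where
    open ≤-Reasoning
    l = length (dividingCodes zero M (suc m))
    select : ∀ c r → 1 * length (onlyIf (c ∣? M) (codes r)) ≤ r ! * divisorIndicator M c
    select c r with c ∣? M
    ... | yes _ = ≤-reflexive (trans (+-identityʳ _) (trans (length-codes r) (sym (*-identityʳ (r !)))))
    ... | no _  = z≤n
    rearrange : ∀ a b c → a * (b * c) ≡ b * (a * c)
    rearrange = solve-∀
  length-dividingCodes (suc J) M (suc m) M≤X m<n T≤m = begin
    s * length (dividingCodes (suc J) M (suc m))   ≤⟨ length-cycleCodes-≤ s w 1 m step ⟩
    m ! * sumCycles w 1 m                          ≤⟨ *-monoʳ-≤ (m !) (sumCycles-below (suc J) s T 1 m) ⟩
    m ! * (suc J * suc m + s * T)                  ≤⟨ *-monoʳ-≤ (m !) (+-monoʳ-≤ (suc J * suc m) T≤m) ⟩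
    m ! * (suc J * suc m + suc m)                  ≡⟨ rearrange (m !) J (suc m) ⟩
    suc (suc J) * (suc m) !                        ∎
    where
    open ≤-Reasoning
    T = threshold J
    -- From `T` on, the induction hypothesis costs `suc J`; below `T`, the extra `s` pays for the
    -- crude bound `r !`.
    w : ℕ → ℕ → ℕ
    w _ r = suc J + s * below T r
    rearrange : ∀ a J b → a * ((1 + J) * b + b) ≡ (2 + J) * (b * a)
    rearrange = solve-∀
    regroup : ∀ a b c → a * b * c ≡ a * (b * c)
    regroup = solve-∀
    step : ∀ c r → .{{NonZero c}} → c + r ≡ 1 + m → s * length (dividingCodes J (M * c) r) ≤ r ! * w c r
    step c r eq with r <? T
    ... | yes _ = begin
      s * length (dividingCodes J (M * c) r)  ≤⟨ *-monoʳ-≤ s (length-dividingCodes-≤! J (M * c) r) ⟩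
      s * r !                                 ≡⟨ *-comm s (r !) ⟩
      r ! * s                                 ≤⟨ *-monoʳ-≤ (r !) (subst (_≤ suc J + s * 1) (*-identityʳ s) (m≤n+m (s * 1) (suc J))) ⟩
      r ! * (suc J + s * 1)                   ∎
    ... | no r≮T = begin
      s * length (dividingCodes J (M * c) r)  ≤⟨ length-dividingCodes J (M * c) r {{m*n≢0 M c}} Mc≤X r≤n (≮⇒≥ r≮T) ⟩
      suc J * r !                             ≡⟨ *-comm (suc J) (r !) ⟩
      r ! * suc J                             ≤⟨ *-monoʳ-≤ (r !) (m≤m+n (suc J) (s * 0)) ⟩
      r ! * (suc J + s * 0)                   ∎
      where
      c≤n : c ≤ n
      c≤n = ≤-trans (m+n≤o⇒m≤o c (≤-reflexive eq)) m<n
      r≤n : r ≤ n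
      r≤n = ≤-trans (m+n≤o⇒n≤o c (≤-reflexive eq)) m<n
      Mc≤X : M * c * n ^ J ≤ X
      Mc≤X = begin
        M * c * n ^ J    ≡⟨ regroup M c (n ^ J) ⟩
        M * (c * n ^ J)  ≤⟨ *-monoʳ-≤ M (*-monoˡ-≤ (n ^ J) c≤n) ⟩
        M * (n * n ^ J)  ≤⟨ M≤X ⟩
        X                ∎

-- Codes of third components

module Classify {n : ℕ} (f : Fin n → Fin n)
  (f-fixed : ∀ {M} (xs : List (Fin n)) → 2 * length xs < n →
             (∀ w → w ∈ xs ⊎ fold w f M ≡ w) → ∀ z → fold z f (2 * n * M) ≡ z) where

  -- In use, `M` is the product of the lengths of the exposed cycles, so that the `M`-th iterate of
  -- `f` fixes every exposed point; each further cycle multiplies `M` by its length.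
  classify : ∀ J M {rem e} → Start f rem e → Unique rem → (∀ w → w ∈ rem ⊎ fold w f M ≡ w) →
             e ∈ dividingCodes J (2 * n * M) (length rem) ⊎ e ∈ slowCodes n J (length rem)
  classify J M done _ _ = inj₁ (here refl)
  classify zero M {a ∷ rem} {e} s@(start o) u covered = go (n ≤? 2 * length (a ∷ rem))
    where
    open Exposure (expose 0 u refl (λ 0<i i<1 → contradiction (≤-trans i<1 0<i) (n≮n _)) o)

    go : (d : _) → e ∈ dividingCodes zero (2 * n * M) (length (a ∷ rem)) ⊎ e ∈ onlyIf d (codes (length (a ∷ rem)))
    go (yes _) = inj₂ (start⇒∈codes s)
    go (no few) = inj₁ (∈cycleCodes _ (selected (cycle ∣? 2 * n * M)))
      where
      cycle∣ : cycle ∣ 2 * n * M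
      -- More than half of the points are exposed, so `f-fixed` applies to the first point `a` of
      -- the next cycle.
      cycle∣ = least⇒∣ f {{cycle≢0}} cycleLeast cycleFixed (f-fixed (a ∷ rem) (≰⇒> few) covered a)
      selected : (d : _) → restCode ∈ onlyIf d (codes (length rest))
      selected (yes _)     = start⇒∈codes restRun
      selected (no cycle∤) = contradiction cycle∣ cycle∤
  classify (suc J) M {a ∷ rem} {e} (start o) u covered =
    Sum.map (λ e∈ → ∈cycleCodes _ (subst (λ M′ → restCode ∈ dividingCodes J M′ (length rest)) (sym (*-assoc (2 * n) M cycle)) e∈))
            (λ e∈ → ∈cycleCodes _ e∈)
            (classify J (M * cycle) restRun restUnique covered′)
    where
    open Exposure (expose 0 u refl (λ 0<i i<1 → contradiction (≤-trans i<1 0<i) (n≮n _)) o)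

    onCycle : ∀ i → fold (fold a f i) f (M * cycle) ≡ fold a f i
    onCycle i = fold-fixed-∣ f {k = cycle} (n∣m*n M) (trans (fold-swap f a i cycle) (cong (λ b → fold b f i) cycleFixed))

    covered′ : ∀ w → w ∈ rest ⊎ fold w f (M * cycle) ≡ w
    covered′ w with covered w
    ... | inj₂ fix         = inj₂ (fold-fixed-∣ f {k = M} (m∣m*n cycle) fix)
    ... | inj₁ (here refl) = inj₂ (onCycle 0)
    ... | inj₁ (there w∈) with exhausts w∈
    ...   | inj₁ w∈rest     = inj₁ w∈rest
    ...   | inj₂ (i , refl) = inj₂ (onCycle i)

thirdComponents : ∀ n → List (Permutation′ n)
thirdComponents n = filter (isThirdComponent? n) (permutations n)

length-thirdComponents : ∀ n J →
  length (thirdComponents n) ≤ length (dividingCodes J (2 * n) n) + length (slowCodes n J n)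
length-thirdComponents n J = subst (length (thirdComponents n) ≤_) (length-++ (dividingCodes J (2 * n) n))
  (length-≤-injective (λ π e → Start (π ⟨$⟩ʳ_) (allFin n) e) _
    (λ s s′ i → code-injective s s′ (∈-allFin i))
    (Uniqueₛ.filter⁺ (permutationSetoid n) (isThirdComponent? n) (permutations-unique n))
    (All.map (λ {γ} → code {γ}) (all-filter (isThirdComponent? n) (permutations n))))
  where
  length-allFin : length (allFin n) ≡ n
  length-allFin = length-tabulate {n = n} (λ i → i)

  code : ∀ {γ} → IsThirdComponent n γ →
         ∃[ e ] e ∈ dividingCodes J (2 * n) n ++ slowCodes n J n × Start (γ ⟨$⟩ʳ_) (allFin n) e
  code {γ} (α , β , L , auto) with encode (⟨$⟩ʳ-injective γ) n length-allFin (allFin⁺ n) (λ _ → ∈-allFin _)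
  ... | e , s = e , [ ∈-++⁺ˡ , ∈-++⁺ʳ _ ]′ classified , s
    where
    open Autoparatopism L α β γ auto
    open Classify (γ ⟨$⟩ʳ_) (λ {M} → γ-fixed {M})
    classified : e ∈ dividingCodes J (2 * n) n ⊎ e ∈ slowCodes n J n
    classified = subst₂ (λ M l → e ∈ dividingCodes J M l ⊎ e ∈ slowCodes n J l) (*-identityʳ (2 * n)) length-allFin
      (classify J 1 s (allFin⁺ n) λ w → inj₁ (∈-allFin w))

-- 2 ^ J ≥ 4 k makes the slow codes, and s = 2 k (J + 1) the dividing codes, at
-- most n ! / (2 k); K > J + 1 makes the number of divisors of M ≤ 2 n ^ (J + 1)
-- at most n / S for n ≥ N.
module Bound (k : ℕ) (k≢0 : NonZero k) where

  private instance _ = k≢0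

  J s S K : ℕ
  J = 2 + k
  s = 2 * k * suc J
  S = s ^ suc J
  K = 2 + J

  open DivisorBound K _

  -- The first summand yields the strict inequality in `small`; the second gives `n ≥ S`, so that
  -- `n / S` is positive.
  N : ℕ
  N = suc (constant * 2 * S ^ K) + S

  instance
    s≢0 : NonZero s
    s≢0 = m*n≢0 (2 * k) (suc J) {{m*n≢0 2 k}}

    S≢0 : NonZero S
    S≢0 = m^n≢0 s (suc J)

  module _ (n : ℕ) (n≥N : n ≥ N) where

    private instance
      n≢0 : NonZero n
      n≢0 = >-nonZero (≤-trans z<s n≥N)

    D X : ℕ
    D = n / S
    X = 2 * n * n ^ J

    D≢0 : NonZero D
    D≢0 = >-nonZero (m≥n⇒m/n>0 (≤-trans (m≤n+m S _) n≥N))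

    -- Otherwise `n < t * S`, and the power `K = J + 2` of this gives `n ^ K < n ^ K`, because `n`
    -- exceeds `constant * 2 * S ^ K`.
    small : ∀ t → t ^ K ≤ constant * X → t ≤ D
    small t t^K≤ = subst (_≤ D) (m*n/n≡m t S) (/-monoˡ-≤ S (≮⇒≥ λ n<tS → <-irrefl refl (begin-strict
      n ^ K                             ≤⟨ ^-monoˡ-≤ K (<⇒≤ n<tS) ⟩
      (t * S) ^ K                       ≡⟨ ^-distribʳ-* t S K ⟩
      t ^ K * S ^ K                     ≤⟨ *-monoˡ-≤ (S ^ K) t^K≤ ⟩
      constant * X * S ^ K              ≡⟨ rearrange constant n (n ^ J) (S ^ K) ⟩
      constant * 2 * S ^ K * n ^ suc J  <⟨ *-monoˡ-< (n ^ suc J) {{m^n≢0 n (suc J)}} (≤-trans (m≤m+n _ S) n≥N) ⟩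
      n * n ^ suc J                     ∎)))
      where
      open ≤-Reasoning
      rearrange : ∀ a b c d → a * (2 * b * c) * d ≡ a * 2 * d * (b * c)
      rearrange = solve-∀

    few : ∀ M m → .{{NonZero M}} → M ≤ X → sumCycles (λ c _ → divisorIndicator M c) 1 m ≤ D
    few M m M≤X with fewDivisors M
    ... | ds , cover , len = ≤-trans (sumCycles-divisors 1 m ds λ _ → cover)
      (small (length ds) (≤-trans len (*-monoʳ-≤ constant M≤X)))

    open Dividing n s D X s≢0 D≢0 few

    threshold≡ : ∀ j → threshold j ≡ D * s ^ suc j
    threshold≡ zero    = trans (*-comm s D) (cong (D *_) (sym (*-identityʳ s)))
    threshold≡ (suc j) = trans (cong (s *_) (threshold≡ j)) (swap s D (s ^ suc j))
      where
      swap : ∀ a b c → a * (b * c) ≡ b * (a * c)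
      swap = solve-∀

    dividing-≤ : 2 * k * length (dividingCodes J (2 * n) n) ≤ n !
    dividing-≤ = *-cancelˡ-≤ (suc J) (begin
      suc J * (2 * k * l)  ≡⟨ *-assoc (suc J) (2 * k) l ⟨
      suc J * (2 * k) * l  ≡⟨ cong (_* l) (*-comm (suc J) (2 * k)) ⟩
      s * l                ≤⟨ length-dividingCodes J (2 * n) n {{m*n≢0 2 n}} ≤-refl ≤-refl
                                (≤-trans (≤-reflexive (threshold≡ J)) (m/n*n≤m n S)) ⟩
      suc J * n !          ∎)
      where
      open ≤-Reasoning
      l = length (dividingCodes J (2 * n) n)

    slow-≤ : 2 * k * length (slowCodes n J n) ≤ n !
    slow-≤ = *-cancelˡ-≤ (2 * n) {{m*n≢0 2 n}} (begin
      2 * n * (2 * k * l)    ≡⟨ regroup n k l ⟩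
      n * (2 * (2 * k)) * l  ≤⟨ *-monoˡ-≤ l (*-monoʳ-≤ n (*-monoʳ-≤ 2 (*-monoʳ-≤ 2 (<⇒≤ (1+n≤2^n k))))) ⟩
      n * 2 ^ J * l          ≤⟨ length-slowCodes n J n ⟩
      2 * n * n !            ∎)
      where
      open ≤-Reasoning
      l = length (slowCodes n J n)
      regroup : ∀ a b c → 2 * a * (2 * b * c) ≡ a * (2 * (2 * b)) * c
      regroup = solve-∀

    thirdComponents-≤ : k * length (thirdComponents n) ≤ n !
    thirdComponents-≤ = *-cancelˡ-≤ 2 (begin
      2 * (k * length (thirdComponents n))  ≡⟨ *-assoc 2 k _ ⟨
      2 * k * length (thirdComponents n)    ≤⟨ *-monoʳ-≤ (2 * k) (length-thirdComponents n J) ⟩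
      2 * k * (length (dividingCodes J (2 * n) n) + length (slowCodes n J n))
        ≡⟨ *-distribˡ-+ (2 * k) (length (dividingCodes J (2 * n) n)) _ ⟩
      2 * k * length (dividingCodes J (2 * n) n) + 2 * k * length (slowCodes n J n)
        ≤⟨ +-mono-≤ dividing-≤ slow-≤ ⟩
      n ! + n !                             ≡⟨ cong (_+_ (n !)) (+-identityʳ (n !)) ⟨
      2 * n !                               ∎)
      where open ≤-Reasoning

-- Passage to rational numbers and the limit

/-<-mkℚ : ∀ a b .{{_ : NonZero b}} c d .(coprime : Coprime (suc c) (suc d)) → suc d * a < b → (ℤ.+ a) ℚ./ b ℚ.< mkℚ (ℤ.+ suc c) d coprime
/-<-mkℚ a (suc b) c d coprime h = ℚ.toℚᵘ-cancel-< (ℚᵘ.<-respˡ-≃ (ℚᵘ.≃-sym (ℚ.toℚᵘ-fromℚᵘ (ℚᵘ.mkℚᵘ (ℤ.+ a) b)))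
  (ℚᵘ.*<* (subst₂ ℤ._<_ (ℤ.pos-* a (suc d)) (ℤ.pos-* (suc c) (suc b)) (ℤ.+<+ (begin-strict
    a * suc d      ≡⟨ *-comm a (suc d) ⟩
    suc d * a      <⟨ h ⟩
    -- The numerator `suc c` is at least 1, so staying below `1 / suc d` is enough.
    suc b          ≤⟨ m≤n*m (suc b) (suc c) ⟩
    suc c * suc b  ∎)))))
  where open ≤-Reasoning

theorem6p2 : p ⟶ 0ℚ
theorem6p2 ε@(mkℚ (ℤ.+ suc c) d coprime) _ = N , λ n n≥N →
  subst (ℚ._< ε) (sym (∣p-0∣≡p n)) (/-<-mkℚ (length (thirdComponents n)) (n !) {{n !≢0}} c d coprime
    (strict (suc d) (length (thirdComponents n)) (n !) {{n !≢0}} (thirdComponents-≤ n n≥N)))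
  where
  -- One more than the denominator `suc d` of `ε`, which turns the weak bound into a strict one.
  open Bound (2 + d) _

  strict : ∀ k l b .{{_ : NonZero b}} → suc k * l ≤ b → k * l < b
  strict k zero    b _ = subst (_< b) (sym (*-zeroʳ k)) (>-nonZero⁻¹ b)
  strict k (suc l) b h = <-≤-trans (m<n+m (k * suc l) z<s) h

  ∣p-0∣≡p : ∀ n → ℚ.∣ p n ℚ.- 0ℚ ∣ ≡ p n
  ∣p-0∣≡p n = trans (cong ℚ.∣_∣ (ℚ.+-identityʳ (p n)))
    (ℚ.0≤p⇒∣p∣≡p (ℚ.nonNegative⁻¹ (p n) {{ℚ.normalize-nonNeg (length (thirdComponents n)) (n !) {{n !≢0}}}}))
theorem6p2 (mkℚ (ℤ.+ 0) _ _)      (*<* (ℤ.+<+ ()))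
theorem6p2 (mkℚ ℤ.-[1+ _ ] _ _) (*<* ())
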